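{- There exists an absolute constant $C>0$ such that the following holds. Let $G=(V,E)$ be an undirected multigraph with $m$ edges that is not a forest, let $\rho=\max_{\varnothing\neq S\subseteq V}\frac{|E(S)|}{|S|}$, let $\varepsilon\in(0,1]$, and let $P_1,\ldots,P_k$ be a greedy minimum-weight maximal pseudoforest packing of $G$ with $k\ge C\rho\log m/\varepsilon^2$. Then every edge of $G$ lies in at least one $P_i$, and in the fractional orientation induced by $P_1,\ldots,P_k$ every vertex $u$ satisfies $\mathrm{outdeg}(u)\le(1+\varepsilon)\rho$.
   Context: $E(S)$ is the set of edges with both endpoints in $S$. A pseudoforest is an edge set $P\subseteq E$ in which every connected component has at most one cycle; a maximal pseudoforest is an inclusion-maximal one (a base of the bicircular matroid of $G$). A greedy minimum-weight maximal pseudoforest packing is a sequence $P_1,P_2,\ldots$ where $P_j$ is a minimum-weight maximal pseudoforest with respect to the weights $w_j(e)=|\{i<j: e\in P_i\}|$ (ties arbitrary). The orientation of a pseudoforest $P$: in each component containing a cycle, orient the cycle cyclically and orient all other edges towards the cycle; in each acyclic component, choose a root and orient all edges towards it (so every vertex has out-degree at most 1). The fractional orientation induced by $P_1,\ldots,P_k$ (when each edge lies in some $P_i$) sets, for $(u,v)\in E$, $d_{u\to v}=\frac{|\{i: (u,v)\in P_i \text{ and oriented } u\to v \text{ in the orientation of } P_i\}|}{|\{i:(u,v)\in P_i\}|}$, and $\mathrm{outdeg}(u)=\sum_{(u,v)\in E}d_{u\to v}$. $\log$ is the natural logarithm. -}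

module Defs where

open import Data.Nat as ℕ using (ℕ; zero; suc)
open import Data.Fin using (Fin; toℕ) renaming (zero to fzero; suc to fsuc)
open import Data.Fin using (fromℕ)
open import Data.Bool using (Bool; true; false; if_then_else_; _∧_; _∨_)
open import Relation.Nullary.Decidable using (isYes)
import Data.Fin
open import Data.Product using (Σ; ∃; _×_; _,_; proj₁; proj₂)
open import Data.Sum using (_⊎_)
open import Data.Integer as ℤ using (ℤ; +_)
open import Data.Rational as ℚ using (ℚ; 0ℚ; 1ℚ; _/_)
open import Relation.Binary.PropositionalEquality using (_≡_)
open import Relation.Nullary using (¬_)
open import Function.Definitions using (Injective)

sumℕ : ∀ {k} → (Fin k → ℕ) → ℕ
sumℕ {zero}  f = 0
sumℕ {suc k} f = f fzero ℕ.+ sumℕ (λ i → f (fsuc i))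

sumℚ : ∀ {k} → (Fin k → ℚ) → ℚ
sumℚ {zero}  f = 0ℚ
sumℚ {suc k} f = f fzero ℚ.+ sumℚ (λ i → f (fsuc i))

-- a / b as a rational (0 if b = 0; only used with b > 0)
frac : ℕ → ℕ → ℚ
frac a zero    = 0ℚ
frac a (suc b) = (+ a) / suc b

count : ∀ {k} → (Fin k → Bool) → ℕ
count f = sumℕ (λ i → if f i then 1 else 0)

ℕtoℚ : ℕ → ℚ
ℕtoℚ a = (+ a) / 1

-- Multigraphs: vertices Fin n, edges Fin m, each edge has an
-- (unordered, stored as a pair) pair of endpoints; loops and parallel
-- edges allowed.

record Multigraph : Set where
  field
    n    : ℕ
    m    : ℕ
    ends : Fin m → Fin n × Fin n

module _ (G : Multigraph) where
  open Multigraph G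

  Vertex : Set
  Vertex = Fin n

  Edge : Set
  Edge = Fin m

  EdgeSet : Set
  EdgeSet = Edge → Bool

  VertexSet : Set
  VertexSet = Vertex → Bool

  allEdges : EdgeSet
  allEdges _ = true

  Joins : Edge → Vertex → Vertex → Set
  Joins e u v = (ends e ≡ (u , v)) ⊎ (ends e ≡ (v , u))

  inducedCount : VertexSet → ℕ
  inducedCount S = count (λ e → S (proj₁ (ends e)) ∧ S (proj₂ (ends e)))

  IsMaxDensity : ℚ → Set
  IsMaxDensity ρ =
    (∀ (S : VertexSet) → 0 ℕ.< count S →
        ℕtoℚ (inducedCount S) ℚ.≤ ρ ℚ.* ℕtoℚ (count S))
    × (Σ VertexSet λ S → (0 ℕ.< count S) ×
        (ℕtoℚ (inducedCount S) ≡ ρ ℚ.* ℕtoℚ (count S)))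

  data Walk (P : EdgeSet) : Vertex → Vertex → ℕ → Set where
    nil  : ∀ {u} → Walk P u u 0
    step : ∀ {u w v l} (e : Edge) → P e ≡ true → Joins e u w →
           Walk P w v l → Walk P u v (suc l)

  Connected : EdgeSet → Vertex → Vertex → Set
  Connected P u v = ∃ λ l → Walk P u v l

  -- cyclic successor on Fin (suc k): i ↦ i+1 mod (k+1)
  next : ∀ {k} → Fin (suc k) → Fin (suc k)
  next {zero}  _        = fzero
  next {suc k} fzero    = fsuc fzero
  next {suc k} (fsuc i) with next {k} i
  ... | fzero  = fzero
  ... | fsuc r = fsuc (fsuc r)

  record Cycle (P : EdgeSet) : Set where
    field
      len     : ℕ
      vs      : Fin (suc len) → Vertex
      es      : Fin (suc len) → Edge
      vs-inj  : Injective _≡_ _≡_ vs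
      es-inj  : Injective _≡_ _≡_ es
      es-in   : ∀ j → P (es j) ≡ true
      es-join : ∀ j → Joins (es j) (vs j) (vs (next j))

  InCycle : ∀ {P} → Cycle P → Edge → Set
  InCycle Z e = ∃ λ j → Cycle.es Z j ≡ e

  CycleNear : ∀ {P} → Cycle P → Vertex → Set
  CycleNear {P} Z v = ∃ λ j → Connected P v (Cycle.vs Z j)

  -- every connected component of (V,P) has at most one cycle:
  -- two cycles in the same component have the same edge set
  IsPseudoforest : EdgeSet → Set
  IsPseudoforest P =
    ∀ (Z₁ Z₂ : Cycle P) → CycleNear Z₂ (Cycle.vs Z₁ fzero) →
      ∀ e → (InCycle Z₁ e → InCycle Z₂ e) × (InCycle Z₂ e → InCycle Z₁ e)

  add : EdgeSet → Edge → EdgeSet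
  add P e f = isYes (e Data.Fin.≟ f) ∨ P f

  IsMaximalPseudoforest : EdgeSet → Set
  IsMaximalPseudoforest P =
    IsPseudoforest P × (∀ e → P e ≡ false → ¬ IsPseudoforest (add P e))

  weight : (Edge → ℕ) → EdgeSet → ℕ
  weight w P = sumℕ (λ e → if P e then w e else 0)

  IsMinWeightMaxPseudoforest : (Edge → ℕ) → EdgeSet → Set
  IsMinWeightMaxPseudoforest w P =
    IsMaximalPseudoforest P ×
    (∀ Q → IsMaximalPseudoforest Q → weight w P ℕ.≤ weight w Q)

  -- w_j(e) = |{ i < j : e ∈ P_i }|   (P_{i+1} is Ps i)
  packWeight : ∀ {k} → (Fin k → EdgeSet) → Fin k → Edge → ℕ
  packWeight Ps j e = count (λ i → Ps i e ∧ (toℕ i ℕ.<ᵇ toℕ j))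

  IsGreedyPacking : ∀ {k} → (Fin k → EdgeSet) → Set
  IsGreedyPacking Ps = ∀ j → IsMinWeightMaxPseudoforest (packWeight Ps j) (Ps j)

  Orientation : Set
  Orientation = Edge → Bool

  Tail : Orientation → Edge → Vertex
  Tail o e = if o e then proj₁ (ends e) else proj₂ (ends e)

  Head : Orientation → Edge → Vertex
  Head o e = if o e then proj₂ (ends e) else proj₁ (ends e)

  DistToCycleLe : ∀ {P} → Cycle P → Vertex → ℕ → Set
  DistToCycleLe {P} Z v d = ∃ λ j → ∃ λ l → (l ℕ.≤ d) × Walk P v (Cycle.vs Z j) l

  DistLe : EdgeSet → Vertex → Vertex → ℕ → Set
  DistLe P v r d = ∃ λ l → (l ℕ.≤ d) × Walk P v r l

  TowardsCycle : ∀ {P} → Cycle P → Vertex → Vertex → Set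
  TowardsCycle Z x y = ∃ λ d → DistToCycleLe Z y d × ¬ DistToCycleLe Z x d

  TowardsRoot : EdgeSet → Vertex → Vertex → Vertex → Set
  TowardsRoot P r x y = ∃ λ d → DistLe P y r d × ¬ DistLe P x r d

  -- o is "the orientation of the pseudoforest P" (for some choice of
  -- cycle direction and roots):
  --  * each cycle is oriented cyclically (all edges forward or all backward);
  --  * in a component containing a cycle Z, every other edge points towards Z;
  --  * in each acyclic component there is a root r such that every edge of
  --    that component points towards r.
  IsOrientationOf : EdgeSet → Orientation → Set
  IsOrientationOf P o =
    (∀ (Z : Cycle P) →
        (∀ j → (Tail o (Cycle.es Z j) ≡ Cycle.vs Z j) ×
               (Head o (Cycle.es Z j) ≡ Cycle.vs Z (next j)))
      ⊎ (∀ j → (Tail o (Cycle.es Z j) ≡ Cycle.vs Z (next j)) ×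
               (Head o (Cycle.es Z j) ≡ Cycle.vs Z j)))
    × (∀ (Z : Cycle P) (e : Edge) → P e ≡ true → ¬ InCycle Z e →
          CycleNear Z (Tail o e) → TowardsCycle Z (Tail o e) (Head o e))
    × (∀ (v : Vertex) → (∀ (Z : Cycle P) → ¬ CycleNear Z v) →
          Σ Vertex λ r → Connected P v r ×
            (∀ e → P e ≡ true → Connected P v (Tail o e) →
                TowardsRoot P r (Tail o e) (Head o e)))

  fracOut : ∀ {k} → (Fin k → EdgeSet) → (Fin k → Orientation) → Edge → Vertex → ℚ
  fracOut Ps os e u =
    frac (count (λ i → Ps i e ∧ isYes (Tail (os i) e Data.Fin.≟ u)))
         (count (λ i → Ps i e))

  outdeg : ∀ {k} → (Fin k → EdgeSet) → (Fin k → Orientation) → Vertex → ℚ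
  outdeg Ps os u =
    sumℚ (λ e → if isYes (proj₁ (ends e) Data.Fin.≟ u) ∨ isYes (proj₂ (ends e) Data.Fin.≟ u)
                then fracOut Ps os e u else 0ℚ)

-- Natural logarithm bound without reals:
-- expPartial N t = Σ_{j=0}^{N} t^j / j!
powℚ : ℚ → ℕ → ℚ
powℚ t zero    = 1ℚ
powℚ t (suc j) = t ℚ.* powℚ t j

expPartial : ℕ → ℚ → ℚ
expPartial zero    t = 1ℚ
expPartial (suc N) t = expPartial N t ℚ.+ powℚ t (suc N) ℚ.* frac 1 (suc N ℕ.!)

-- LnLeQuot m a b  means  log m ≤ a / b  (for b > 0):
-- t = a / b and m ≤ exp t, witnessed by a partial sum of the exponential series.
LnLeQuot : ℕ → ℚ → ℚ → Set
LnLeQuot m a b = Σ ℚ λ t → (t ℚ.* b ≡ a) × ∃ λ N → ℕtoℚ m ℚ.≤ expPartial N t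

{-# OPTIONS --safe #-}
module Submission where

-- Since each P_i has out-degree at most one, it suffices that every edge e lies in
-- c(e) ≥ k / ((1 + ε) ρ) of the P_i.  With η = ε / 4, minimising the weight c is the same as
-- maximising the weight (1 - η)^c(e), so greedy packing is a multiplicative-weights algorithm.
-- For a minimum-weight P and every t, P contains at least |F| / ρ edges of F = {c ≤ t}; by Abel
-- summation each step then shrinks the potential Φ = Σ (1 - η)^c(e) by the factor 1 - η / ρ.
-- Hence (1 - η)^c(e) ≤ Φ ≤ m (1 - η / ρ)^k, which together with m ≤ exp (k ε² / (32 ρ)) bounds c(e).
--
-- A pseudoforest is an edge set whose edges can be assigned injectively to endpoints.
-- Constructively, such an assignment is only obtained under a double negation, which
-- is harmless because it is only used to prove decidable statements.

open import Defs
open import Data.Nat using (ℕ; _≤_)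
open import Data.Fin using (Fin)
open import Data.Bool using (true)
open import Data.Product using (Σ; ∃; _×_)
open import Data.Rational using (ℚ; 0ℚ; 1ℚ; _+_; _*_; _<_) renaming (_≤_ to _≤ℚ_)
open import Relation.Binary.PropositionalEquality using (_≡_)

open import Data.Bool using (Bool; false; if_then_else_; _∧_; _∨_; not; T)
open import Data.Bool.Properties using () renaming (_≟_ to _≟ᵇ_)
open import Data.Empty using (⊥; ⊥-elim)
open import Data.Fin as Fin using (toℕ; fromℕ; inject₁)
open import Data.Fin.Induction using (<-weakInduction; >-weakInduction)
import Data.Fin.Properties as FinP
open import Data.Fin.Relation.Unary.Top using (view; ‵fromℕ; ‵inject₁)
open import Data.Integer as ℤ using ()
import Data.Integer.Properties as ℤP
open import Data.Nat as ℕ using (zero; suc)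
open import Data.Nat.Induction using (<-rec)
import Data.Nat.Properties as ℕP
open import Data.Nat.Solver using () renaming (module +-*-Solver to ℕ-Solver)
open import Data.Product using (_,_; proj₁; proj₂)
open import Data.Rational using (_-_; -_; _/_; 1/_; Positive; positive; nonNegative; toℚᵘ)
open import Data.Rational.Properties
open import Data.Rational.Solver using (module +-*-Solver)
import Data.Rational.Unnormalised as ℚᵘ
import Data.Rational.Unnormalised.Properties as ℚᵘP
open import Data.Sum using (_⊎_; inj₁; inj₂)
open import Data.Unit using (tt)
open import Relation.Binary.Definitions using (tri<; tri≈; tri>)
open import Relation.Binary.PropositionalEquality
open import Relation.Nullary using (¬_; Dec; yes; no)
open import Relation.Nullary.Decidable using (isYes; _×-dec_; decidable-stable; ¬¬-excluded-middle)

-- Level sets are handled by augmenting paths instead of matroid theory. For `H`, the part of `P`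
-- inside `F`, let `U` be the vertices from which no vertex left free by `H` is reached. Maximality
-- and minimality of `P` force every edge of `F` missing from `P` to lie inside `U`, and the edges
-- assigned to `U` lie inside `U` as well, so `|F| ≤ |E(U)| + |H outside U| ≤ ρ|U| + ρ|H outside U|
-- ≤ ρ|H|`. This uses `ρ ≥ 1`, which is what a cycle in `G` provides. The logarithm is available
-- only through partial sums of the exponential series, so the final estimate compares powers of
-- rationals. The hypothesis gives `m ≤ (1 + η²/ρ)^k`; the constant is `32 = 2 · 4²`, from `η = ε/4`
-- and from `exp y ≤ 1 + 2y`. If some `c(e)` were too small, weighted AM-GM would bound a `c(e)`-th
-- power by a `k`-th power and contradict the potential bound. The prescribed orientation speaks of
-- graph distances. It is matched with an assignment by showing that an edge pointing towards a
-- cycle or a root is assigned to its tail.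

toℚᵘ-ℕtoℚ : ∀ a → toℚᵘ (ℕtoℚ a) ℚᵘ.≃ ℚᵘ.mkℚᵘ (ℤ.+ a) 0
toℚᵘ-ℕtoℚ a = toℚᵘ-fromℚᵘ (ℚᵘ.mkℚᵘ (ℤ.+ a) 0)

ℕtoℚ-+ : ∀ a b → ℕtoℚ (a ℕ.+ b) ≡ ℕtoℚ a + ℕtoℚ b
ℕtoℚ-+ a b = toℚᵘ-injective (begin
  toℚᵘ (ℕtoℚ (a ℕ.+ b)) ≈⟨ toℚᵘ-ℕtoℚ (a ℕ.+ b) ⟩
  ℚᵘ.mkℚᵘ (ℤ.+ (a ℕ.+ b)) 0 ≈⟨ ℚᵘ.*≡* (cong (ℤ._* ℤ.+ 1) (sym (cong₂ ℤ._+_ (ℤP.*-identityʳ (ℤ.+ a))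
            (ℤP.*-identityʳ (ℤ.+ b))))) ⟩
  ℚᵘ.mkℚᵘ (ℤ.+ a) 0 ℚᵘ.+ ℚᵘ.mkℚᵘ (ℤ.+ b) 0 ≈⟨ ℚᵘP.+-cong (toℚᵘ-ℕtoℚ a) (toℚᵘ-ℕtoℚ b) ⟨
  toℚᵘ (ℕtoℚ a) ℚᵘ.+ toℚᵘ (ℕtoℚ b) ≈⟨ toℚᵘ-homo-+ (ℕtoℚ a) (ℕtoℚ b) ⟨
  toℚᵘ (ℕtoℚ a + ℕtoℚ b) ∎)
  where open ℚᵘP.≃-Reasoning

ℕtoℚ-mono-≤ : ∀ {a b} → a ℕ.≤ b → ℕtoℚ a ≤ℚ ℕtoℚ b
ℕtoℚ-mono-≤ {a} {b} a≤b = toℚᵘ-cancel-≤ (begin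
  toℚᵘ (ℕtoℚ a) ≃⟨ toℚᵘ-ℕtoℚ a ⟩
  ℚᵘ.mkℚᵘ (ℤ.+ a) 0 ≤⟨ ℚᵘ.*≤* (ℤP.*-monoʳ-≤-nonNeg (ℤ.+ 1) (ℤ.+≤+ a≤b)) ⟩
  ℚᵘ.mkℚᵘ (ℤ.+ b) 0 ≃⟨ toℚᵘ-ℕtoℚ b ⟨
  toℚᵘ (ℕtoℚ b) ∎)
  where open ℚᵘP.≤-Reasoning

frac-* : ∀ a b → ℕtoℚ (suc b) * frac a (suc b) ≡ ℕtoℚ a
frac-* a b = toℚᵘ-injective (begin
  toℚᵘ (ℕtoℚ (suc b) * frac a (suc b)) ≈⟨ toℚᵘ-homo-* (ℕtoℚ (suc b)) (frac a (suc b)) ⟩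
  toℚᵘ (ℕtoℚ (suc b)) ℚᵘ.* toℚᵘ (frac a (suc b)) ≈⟨ ℚᵘP.*-cong (toℚᵘ-ℕtoℚ (suc b)) (toℚᵘ-fromℚᵘ (ℚᵘ.mkℚᵘ (ℤ.+ a) b)) ⟩
  ℚᵘ.mkℚᵘ (ℤ.+ suc b) 0 ℚᵘ.* ℚᵘ.mkℚᵘ (ℤ.+ a) b ≈⟨ ℚᵘ.*≡* eq ⟩
  ℚᵘ.mkℚᵘ (ℤ.+ a) 0 ≈⟨ toℚᵘ-ℕtoℚ a ⟨
  toℚᵘ (ℕtoℚ a) ∎)
  where
  open ℚᵘP.≃-Reasoning
  eq : ℤ.+ suc b ℤ.* ℤ.+ a ℤ.* ℤ.+ 1 ≡ ℤ.+ a ℤ.* ℤ.+ (1 ℕ.* suc b)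
  eq = trans (ℤP.*-identityʳ (ℤ.+ suc b ℤ.* ℤ.+ a)) (trans (ℤP.*-comm (ℤ.+ suc b) (ℤ.+ a))
         (cong (λ x → ℤ.+ a ℤ.* ℤ.+ x) (sym (ℕP.*-identityˡ (suc b)))))

-- Inequalities and powers in ℚ

-- Polynomial inequalities are certified by an explicit nonnegative slack `d`; what remains is an
-- identity for the ring solver.
≤-diff : ∀ {p q} d → 0ℚ ≤ℚ d → p + d ≡ q → p ≤ℚ q
≤-diff {p} d 0≤d refl = subst (_≤ℚ p + d) (+-identityʳ p) (+-monoʳ-≤ p 0≤d)

0≤+ : ∀ {p q} → 0ℚ ≤ℚ p → 0ℚ ≤ℚ q → 0ℚ ≤ℚ p + q
0≤+ 0≤p 0≤q = +-mono-≤ 0≤p 0≤q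

0≤* : ∀ {p q} → 0ℚ ≤ℚ p → 0ℚ ≤ℚ q → 0ℚ ≤ℚ p * q
0≤* {p} {q} 0≤p 0≤q = subst (_≤ℚ p * q) (*-zeroʳ p) (*-monoˡ-≤-nonNeg p {{nonNegative 0≤p}} 0≤q)

0<* : ∀ {p q} → 0ℚ < p → 0ℚ < q → 0ℚ < p * q
0<* {p} {q} 0<p 0<q = subst (_< p * q) (*-zeroʳ p) (*-monoʳ-<-pos p {{positive 0<p}} 0<q)

*-mono-≤ : ∀ {p q r s} → 0ℚ ≤ℚ r → 0ℚ ≤ℚ q → p ≤ℚ q → r ≤ℚ s → p * r ≤ℚ q * s
*-mono-≤ {q = q} {r} 0≤r 0≤q p≤q r≤s =
  ≤-trans (*-monoʳ-≤-nonNeg r {{nonNegative 0≤r}} p≤q) (*-monoˡ-≤-nonNeg q {{nonNegative 0≤q}} r≤s)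

p≤q⇒0≤q-p : ∀ {p q} → p ≤ℚ q → 0ℚ ≤ℚ q - p
p≤q⇒0≤q-p {p} {q} p≤q = subst (_≤ℚ q - p) (+-inverseʳ p) (+-monoˡ-≤ (- p) p≤q)

0≤ℕtoℚ : ∀ a → 0ℚ ≤ℚ ℕtoℚ a
0≤ℕtoℚ a = ℕtoℚ-mono-≤ {0} {a} ℕ.z≤n

0≤1 : 0ℚ ≤ℚ 1ℚ
0≤1 = 0≤ℕtoℚ 1

0≤sq : ∀ p → 0ℚ ≤ℚ p * p
0≤sq p with ≤-total 0ℚ p
... | inj₁ 0≤p = 0≤* 0≤p 0≤p
... | inj₂ p≤0 = subst (0ℚ ≤ℚ_) (neg-sq p) (0≤* (neg-antimono-≤ p≤0) (neg-antimono-≤ p≤0))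
  where
  open +-*-Solver
  neg-sq : ∀ p → (- p) * (- p) ≡ p * p
  neg-sq = solve 1 (λ p → (:- p) :* (:- p) := p :* p) refl

0≤powℚ : ∀ {t} → 0ℚ ≤ℚ t → ∀ n → 0ℚ ≤ℚ powℚ t n
0≤powℚ 0≤t zero    = 0≤1
0≤powℚ 0≤t (suc n) = 0≤* 0≤t (0≤powℚ 0≤t n)

powℚ-mono : ∀ {s t} → 0ℚ ≤ℚ s → s ≤ℚ t → ∀ n → powℚ s n ≤ℚ powℚ t n
powℚ-mono 0≤s s≤t zero    = ≤-refl
powℚ-mono 0≤s s≤t (suc n) = *-mono-≤ (0≤powℚ 0≤s n) (≤-trans 0≤s s≤t) s≤t (powℚ-mono 0≤s s≤t n)

powℚ-* : ∀ s t n → powℚ (s * t) n ≡ powℚ s n * powℚ t n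
powℚ-* s t zero    = refl
powℚ-* s t (suc n) = trans (cong ((s * t) *_) (powℚ-* s t n)) (lem s t (powℚ s n) (powℚ t n))
  where
  open +-*-Solver
  lem : ∀ s t u v → s * t * (u * v) ≡ s * u * (t * v)
  lem = solve 4 (λ s t u v → s :* t :* (u :* v) := s :* u :* (t :* v)) refl

powℚ-1 : ∀ n → powℚ 1ℚ n ≡ 1ℚ
powℚ-1 zero    = refl
powℚ-1 (suc n) = trans (*-identityˡ _) (powℚ-1 n)

powℚ-≤1 : ∀ {t} → 0ℚ ≤ℚ t → t ≤ℚ 1ℚ → ∀ n → powℚ t n ≤ℚ 1ℚ
powℚ-≤1 0≤t t≤1 n = subst (powℚ _ n ≤ℚ_) (powℚ-1 n) (powℚ-mono 0≤t t≤1 n)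

ℕtoℚ-suc : ∀ n → ℕtoℚ (suc n) ≡ 1ℚ + ℕtoℚ n
ℕtoℚ-suc = ℕtoℚ-+ 1

-- Convexity of the power function: `y^(n+1)` lies above its tangent at `x`, with the negative term
-- moved across. Both the exponential estimate and AM-GM rest on it.
tangent : ∀ {x y} → 0ℚ ≤ℚ x → 0ℚ ≤ℚ y → ∀ n →
          ℕtoℚ (suc n) * (y * powℚ x n) ≤ℚ powℚ y (suc n) + ℕtoℚ n * powℚ x (suc n)
tangent {x} {y} 0≤x 0≤y zero    = ≤-reflexive (lem y x)
  where
  open +-*-Solver
  lem : ∀ y x → 1ℚ * (y * 1ℚ) ≡ y * 1ℚ + 0ℚ * (x * 1ℚ)
  lem = solve 2 (λ y x → con 1ℚ :* (y :* con 1ℚ) := y :* con 1ℚ :+ con 0ℚ :* (x :* con 1ℚ)) refl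
tangent {x} {y} 0≤x 0≤y (suc n) =
  -- The new slack is `y` times the previous one plus `(n+1) x^n (y - x)²`.
  ≤-diff (y * (Y + N * (x * X) - ℕtoℚ (suc n) * (y * X)) + ℕtoℚ (suc n) * X * ((y - x) * (y - x)))
    (0≤+ (0≤* 0≤y (p≤q⇒0≤q-p (tangent 0≤x 0≤y n)))
         (0≤* (0≤* (0≤ℕtoℚ (suc n)) (0≤powℚ 0≤x n)) (0≤sq (y - x))))
    eq
  where
  N = ℕtoℚ n
  X = powℚ x n
  Y = powℚ y (suc n)
  eq : ℕtoℚ (suc (suc n)) * (y * (x * X)) + (y * (Y + N * (x * X) - ℕtoℚ (suc n) * (y * X))
         + ℕtoℚ (suc n) * X * ((y - x) * (y - x)))
       ≡ y * Y + ℕtoℚ (suc n) * (x * (x * X))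
  eq rewrite ℕtoℚ-suc (suc n) | ℕtoℚ-suc n = lem N x X y Y
    where
    open +-*-Solver
    lem : ∀ N x X y Y → (1ℚ + (1ℚ + N)) * (y * (x * X)) + (y * (Y + N * (x * X) - (1ℚ + N) * (y * X))
         + (1ℚ + N) * X * ((y - x) * (y - x)))
       ≡ y * Y + (1ℚ + N) * (x * (x * X))
    lem = solve 5 (λ N x X y Y → (con 1ℚ :+ (con 1ℚ :+ N)) :* (y :* (x :* X)) :+ (y :* (Y :+ N :* (x :* X) :-
              (con 1ℚ :+ N) :* (y :* X))
         :+ (con 1ℚ :+ N) :* X :* ((y :- x) :* (y :- x)))
       := y :* Y :+ (con 1ℚ :+ N) :* (x :* (x :* X))) refl

ℕtoℚ-* : ∀ a b → ℕtoℚ (a ℕ.* b) ≡ ℕtoℚ a * ℕtoℚ b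
ℕtoℚ-* zero    b = sym (*-zeroˡ (ℕtoℚ b))
ℕtoℚ-* (suc a) b = begin
  ℕtoℚ (b ℕ.+ a ℕ.* b)         ≡⟨ ℕtoℚ-+ b (a ℕ.* b) ⟩
  ℕtoℚ b + ℕtoℚ (a ℕ.* b)      ≡⟨ cong (ℕtoℚ b +_) (ℕtoℚ-* a b) ⟩
  ℕtoℚ b + ℕtoℚ a * ℕtoℚ b     ≡⟨ lem (ℕtoℚ a) (ℕtoℚ b) ⟩
  (1ℚ + ℕtoℚ a) * ℕtoℚ b       ≡⟨ cong (_* ℕtoℚ b) (ℕtoℚ-suc a) ⟨
  ℕtoℚ (suc a) * ℕtoℚ b        ∎
  where
  open ≡-Reasoning
  open +-*-Solver
  lem : ∀ a b → b + a * b ≡ (1ℚ + a) * b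
  lem = solve 2 (λ a b → b :+ a :* b := (con 1ℚ :+ a) :* b) refl

frac-inverse : ∀ n → 1 ℕ.≤ n → ℕtoℚ n * frac 1 n ≡ 1ℚ
frac-inverse (suc n) _ = frac-* 1 n

0≤frac : ∀ a n → 0ℚ ≤ℚ frac a n
0≤frac a zero    = ≤-refl
0≤frac a (suc n) = nonNegative⁻¹ (ℤ.+ a / suc n) {{normalize-nonNeg a (suc n)}}

-- Partial sums of the exponential series

frac-factorial : ∀ n → ℕtoℚ (suc n) * frac 1 (suc n ℕ.!) ≡ frac 1 (n ℕ.!)
frac-factorial n = begin
  S * F′                     ≡⟨ *-identityʳ (S * F′) ⟨
  S * F′ * 1ℚ                ≡⟨ cong (S * F′ *_) (frac-inverse (n ℕ.!) (n!>0 n)) ⟨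
  S * F′ * (ℕtoℚ (n ℕ.!) * F) ≡⟨ lem S F′ (ℕtoℚ (n ℕ.!)) F ⟩
  S * ℕtoℚ (n ℕ.!) * F′ * F    ≡⟨ cong (λ x → x * F′ * F) (ℕtoℚ-* (suc n) (n ℕ.!)) ⟨
  ℕtoℚ (suc n ℕ.!) * F′ * F     ≡⟨ cong (_* F) (frac-inverse (suc n ℕ.!) (n!>0 (suc n))) ⟩
  1ℚ * F                     ≡⟨ *-identityˡ F ⟩
  F                          ∎
  where
  n!>0 : ∀ n → 1 ℕ.≤ n ℕ.!
  n!>0 n = ℕ.>-nonZero⁻¹ (n ℕ.!) {{n ℕP.!≢0}}
  S  = ℕtoℚ (suc n)
  F  = frac 1 (n ℕ.!)
  F′ = frac 1 (suc n ℕ.!)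
  open ≡-Reasoning
  open +-*-Solver
  lem : ∀ s g a f → s * g * (a * f) ≡ s * a * g * f
  lem = solve 4 (λ s g a f → s :* g :* (a :* f) := s :* a :* g :* f) refl

-- The tangent inequality at `s`, evaluated at `t` and divided by `(j+1)!`; `F` and `F′` stand for
-- `1/j!` and `1/(j+1)!`.
exp-term : ∀ {t s F F′} j → 0ℚ ≤ℚ t → 0ℚ ≤ℚ s → 0ℚ ≤ℚ F′ → ℕtoℚ (suc j) * F′ ≡ F →
           powℚ s (suc j) * F′ ≤ℚ powℚ t (suc j) * F′ + (s - t) * (powℚ s j * F)
exp-term {t} {s} {F} {F′} j 0≤t 0≤s 0≤F′ refl =
  ≤-diff ((U + N * (s * X) - S * (t * X)) * F′) (0≤* (p≤q⇒0≤q-p (tangent 0≤s 0≤t j)) 0≤F′)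
    (trans (lem s t X U N S F′) (trans (cong (λ c → U * F′ + (c * s - S * t) * (X * F′)) (sym (ℕtoℚ-suc j)))
      (lem₂ s t X U S F′)))
  where
  N = ℕtoℚ j
  S = ℕtoℚ (suc j)
  X = powℚ s j
  U = powℚ t (suc j)
  open +-*-Solver
  lem : ∀ s t X U N S F → s * X * F + (U + N * (s * X) - S * (t * X)) * F ≡
        U * F + ((1ℚ + N) * s - S * t) * (X * F)
  lem = solve 7 (λ s t X U N S F →
          s :* X :* F :+ (U :+ N :* (s :* X) :- S :* (t :* X)) :* F :=
          U :* F :+ ((con 1ℚ :+ N) :* s :- S :* t) :* (X :* F)) refl
  lem₂ : ∀ s t X U S F → U * F + (S * s - S * t) * (X * F) ≡ U * F + (s - t) * (X * (S * F))
  lem₂ = solve 6 (λ s t X U S F → U :* F :+ (S :* s :- S :* t) :* (X :* F) :=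
           U :* F :+ (s :- t) :* (X :* (S :* F))) refl

-- A mean value estimate: the derivative of `expPartial (suc N)` is `expPartial N`, which is largest
-- at the right end `s`.
exp-increment : ∀ N {t s} → 0ℚ ≤ℚ t → t ≤ℚ s →
                expPartial (suc N) s ≤ℚ expPartial (suc N) t + (s - t) * expPartial N s
exp-increment zero {t} {s} 0≤t t≤s = ≤-reflexive (lem s t)
  where
  open +-*-Solver
  lem : ∀ s t → 1ℚ + s * 1ℚ * 1ℚ ≡ (1ℚ + t * 1ℚ * 1ℚ) + (s - t) * 1ℚ
  lem = solve 2 (λ s t → con 1ℚ :+ s :* con 1ℚ :* con 1ℚ :=
          (con 1ℚ :+ t :* con 1ℚ :* con 1ℚ) :+ (s :- t) :* con 1ℚ) refl
exp-increment (suc N) {t} {s} 0≤t t≤s =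
  subst (expPartial (suc (suc N)) s ≤ℚ_)
    (lem (expPartial (suc N) t) (s - t) (expPartial N s)
      (powℚ t (suc (suc N)) * frac 1 (suc (suc N) ℕ.!)) (powℚ s (suc N) * frac 1 (suc N ℕ.!)))
    (+-mono-≤ (exp-increment N 0≤t t≤s)
      (exp-term (suc N) 0≤t (≤-trans 0≤t t≤s) (0≤frac 1 (suc (suc N) ℕ.!)) (frac-factorial (suc N))))
  where
  open +-*-Solver
  lem : ∀ a d b v w → (a + d * b) + (v + d * w) ≡ (a + v) + d * (b + w)
  lem = solve 5 (λ a d b v w → (a :+ d :* b) :+ (v :+ d :* w) := (a :+ v) :+ d :* (b :+ w)) refl

0≤expPartial : ∀ N {t} → 0ℚ ≤ℚ t → 0ℚ ≤ℚ expPartial N t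
0≤expPartial zero    0≤t = 0≤powℚ 0≤t 0
0≤expPartial (suc N) 0≤t =
  0≤+ (0≤expPartial N 0≤t) (0≤* (0≤powℚ 0≤t (suc N)) (0≤frac 1 (suc N ℕ.!)))

-- The estimate `exp y ≤ 1 + 2y` for `y ≤ 1/2`. Partial sums are not multiplicative, so it is proved
-- as a bound on one increment of the argument.
exp-step : ∀ N {t y} → 0ℚ ≤ℚ t → 0ℚ ≤ℚ y → y + y ≤ℚ 1ℚ →
           expPartial N (t + y) ≤ℚ (1ℚ + (y + y)) * expPartial N t
exp-step N {t} {y} 0≤t 0≤y 2y≤1 =
  -- `inc` gives `(1 - y) E ≤ E₀`, and `(1 - y)(1 + 2y) = 1 + y(1 - 2y) ≥ 1`.
  ≤-diff ((y * (1ℚ - (y + y))) * E + (1ℚ + (y + y)) * (E₀ + y * E - E))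
    (0≤+ (0≤* (0≤* 0≤y (p≤q⇒0≤q-p 2y≤1)) (0≤expPartial N (0≤+ 0≤t 0≤y)))
         (0≤* (0≤+ 0≤1 (0≤+ 0≤y 0≤y)) (p≤q⇒0≤q-p (inc N))))
    (lem y E E₀)
  where
  E  = expPartial N (t + y)
  E₀ = expPartial N t
  open +-*-Solver
  lem : ∀ y E E₀ → E + ((y * (1ℚ - (y + y))) * E + (1ℚ + (y + y)) * (E₀ + y * E - E)) ≡ (1ℚ + (y + y)) * E₀
  lem = solve 3 (λ y E E₀ → E :+ ((y :* (con 1ℚ :- (y :+ y))) :* E :+ (con 1ℚ :+ (y :+ y)) :* (E₀ :+ y :* E :- E)) :=
          (con 1ℚ :+ (y :+ y)) :* E₀) refl
  cancel : ∀ t y → (t + y) - t ≡ y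
  cancel = solve 2 (λ t y → (t :+ y) :- t := y) refl
  t≤s : t ≤ℚ t + y
  t≤s = ≤-diff y 0≤y refl
  inc : ∀ N → expPartial N (t + y) ≤ℚ expPartial N t + y * expPartial N (t + y)
  inc zero    = ≤-diff y 0≤y (cong (1ℚ +_) (sym (*-identityʳ y)))
  inc (suc N) = ≤-trans (exp-increment N 0≤t t≤s)
    (+-monoʳ-≤ (expPartial (suc N) t)
      (subst (λ d → d * expPartial N (t + y) ≤ℚ y * expPartial (suc N) (t + y)) (sym (cancel t y))
        (*-monoˡ-≤-nonNeg y {{nonNegative 0≤y}}
          (≤-diff _ (0≤* (0≤powℚ (0≤+ 0≤t 0≤y) (suc N)) (0≤frac 1 (suc N ℕ.!))) refl))))

-- Uniform in `N`, so it applies to whichever partial sum witnesses the logarithm hypothesis.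
exp-≤-pow : ∀ N {y} → 0ℚ ≤ℚ y → y + y ≤ℚ 1ℚ → ∀ k →
            expPartial N (ℕtoℚ k * y) ≤ℚ powℚ (1ℚ + (y + y)) k
exp-≤-pow N {y} 0≤y 2y≤1 zero = ≤-reflexive (trans (cong (expPartial N) (*-zeroˡ y)) (exp0 N))
  where
  exp0 : ∀ N → expPartial N 0ℚ ≡ 1ℚ
  exp0 zero    = refl
  exp0 (suc N) = trans (cong₂ _+_ (exp0 N)
    (trans (cong (_* frac 1 (suc N ℕ.!)) (*-zeroˡ (powℚ 0ℚ N))) (*-zeroˡ (frac 1 (suc N ℕ.!)))))
    (+-identityʳ 1ℚ)
exp-≤-pow N {y} 0≤y 2y≤1 (suc k) = begin
  expPartial N (ℕtoℚ (suc k) * y)              ≡⟨ cong (expPartial N) eq ⟩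
  expPartial N (ℕtoℚ k * y + y)                ≤⟨ exp-step N (0≤* (0≤ℕtoℚ k) 0≤y) 0≤y 2y≤1 ⟩
  (1ℚ + (y + y)) * expPartial N (ℕtoℚ k * y)   ≤⟨ *-monoˡ-≤-nonNeg (1ℚ + (y + y)) {{nonNegative 0≤1+2y}}
            (exp-≤-pow N 0≤y 2y≤1 k) ⟩
  powℚ (1ℚ + (y + y)) (suc k)                  ∎
  where
  open ≤-Reasoning
  0≤1+2y : 0ℚ ≤ℚ 1ℚ + (y + y)
  0≤1+2y = 0≤+ 0≤1 (0≤+ 0≤y 0≤y)
  eq : ℕtoℚ (suc k) * y ≡ ℕtoℚ k * y + y
  eq rewrite ℕtoℚ-suc k = lem (ℕtoℚ k) y
    where
    open +-*-Solver
    lem : ∀ k y → (1ℚ + k) * y ≡ k * y + y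
    lem = solve 2 (λ k y → (con 1ℚ :+ k) :* y := k :* y :+ y) refl

-- Weighted AM–GM for n copies of A and d copies of 1; one more copy of 1 is the
-- tangent inequality at the previous mean.
am-gm : ∀ n {A} → 0ℚ ≤ℚ A → ∀ d {Z} → 0ℚ ≤ℚ Z →
        ℕtoℚ (suc n) * A + ℕtoℚ d ≤ℚ ℕtoℚ (d ℕ.+ suc n) * Z →
        powℚ A (suc n) ≤ℚ powℚ Z (d ℕ.+ suc n)
am-gm n {A} 0≤A zero {Z} 0≤Z le = powℚ-mono 0≤A
  (*-cancelˡ-≤-pos (ℕtoℚ (suc n)) {{normalize-pos (suc n) 1}}
    (subst (_≤ℚ ℕtoℚ (suc n) * Z) (+-identityʳ (ℕtoℚ (suc n) * A)) le)) (suc n)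
am-gm n {A} 0≤A (suc d) {Z} 0≤Z le = ≤-trans (am-gm n 0≤A d 0≤Y (≤-reflexive (sym kY)))
    (≤-diff (((Z * W + K * (Y * V)) - ℕtoℚ (suc k) * (Z * V)) + V * (ℕtoℚ (suc k) * Z - (K * Y + 1ℚ)))
      (0≤+ (p≤q⇒0≤q-p (tangent 0≤Y 0≤Z k)) (0≤* (0≤powℚ 0≤Y k) (p≤q⇒0≤q-p le′)))
      (lem Z W K Y V (ℕtoℚ (suc k))))
  where
  k = d ℕ.+ suc n
  K = ℕtoℚ k
  B = ℕtoℚ (suc n) * A + ℕtoℚ d
  Y = B * frac 1 k
  V = powℚ Y k
  W = powℚ Z k
  open +-*-Solver
  lem : ∀ Z W K Y V S → V + (((Z * W + K * (Y * V)) - S * (Z * V)) + V * (S * Z - (K * Y + 1ℚ))) ≡ Z * W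
  lem = solve 6 (λ Z W K Y V S → V :+ (((Z :* W :+ K :* (Y :* V)) :- S :* (Z :* V)) :+ V :* (S :* Z :-
            (K :* Y :+ con 1ℚ))) := Z :* W) refl
  comm₃ : ∀ k b f → k * (b * f) ≡ b * (k * f)
  comm₃ = solve 3 (λ k b f → k :* (b :* f) := b :* (k :* f)) refl
  0≤Y : 0ℚ ≤ℚ Y
  0≤Y = 0≤* (0≤+ (0≤* (0≤ℕtoℚ (suc n)) 0≤A) (0≤ℕtoℚ d)) (0≤frac 1 k)
  kY : K * Y ≡ B
  kY = trans (comm₃ K B (frac 1 k))
         (trans (cong (B *_) (frac-inverse k (ℕP.≤-trans (ℕ.s≤s ℕ.z≤n) (ℕP.m≤n+m (suc n) d)))) (*-identityʳ B))
  le′ : K * Y + 1ℚ ≤ℚ ℕtoℚ (suc k) * Z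
  le′ = subst (_≤ℚ ℕtoℚ (suc k) * Z)
          (trans (cong (ℕtoℚ (suc n) * A +_) (ℕtoℚ-suc d))
            (trans (lem₂ (ℕtoℚ (suc n) * A) (ℕtoℚ d)) (cong (_+ 1ℚ) (sym kY)))) le
    where
    lem₂ : ∀ p q → p + (1ℚ + q) ≡ p + q + 1ℚ
    lem₂ = solve 2 (λ p q → p :+ (con 1ℚ :+ q) := p :+ q :+ con 1ℚ) refl

-- From the potential bound to the multiplicity bound

1<pow : ∀ {δ} → 0ℚ < δ → ∀ n → 1ℚ < powℚ (1ℚ + δ) (suc n)
1<pow {δ} 0<δ n = begin-strict
  1ℚ                          ≡⟨ +-identityʳ 1ℚ ⟨
  1ℚ + 0ℚ                     <⟨ +-monoʳ-< 1ℚ 0<δ ⟩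
  1ℚ + δ                      ≡⟨ *-identityʳ (1ℚ + δ) ⟨
  (1ℚ + δ) * 1ℚ               ≡⟨ cong ((1ℚ + δ) *_) (powℚ-1 n) ⟨
  (1ℚ + δ) * powℚ 1ℚ n        ≤⟨ *-monoˡ-≤-nonNeg (1ℚ + δ) {{nonNegative (0≤+ 0≤1 (<⇒≤ 0<δ))}}
                                   (powℚ-mono 0≤1 (≤-diff δ (<⇒≤ 0<δ) refl) n) ⟩
  powℚ (1ℚ + δ) (suc n)       ∎
  where open ≤-Reasoning

<⇒≱ : ∀ {p q} → p < q → ¬ (q ≤ℚ p)
<⇒≱ p<q q≤p = <-irrefl refl (<-≤-trans p<q q≤p)

-- Stands in for taking logarithms. The hypotheses yield `q^c (1 + z)^k ≤ 1`. If `c(1 + ε)ρ < k`,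
-- AM-GM yields `(1 + a)^c ≤ (1 + z)^k`, hence `(q (1 + a))^c ≤ 1`, although `q (1 + a) = 1 + δ`
-- exceeds 1.
counting-bound : ∀ {ρ r ε} m k c N t → 1ℚ ≤ℚ ρ → r * ρ ≡ 1ℚ → 0ℚ < ε → ε ≤ℚ 1ℚ → 1 ℕ.≤ k →
      t * (ℕtoℚ 32 * ρ) ≡ ℕtoℚ k * ε * ε → ℕtoℚ m ≤ℚ expPartial N t →
      powℚ (1ℚ - frac 1 4 * ε) c ≤ℚ ℕtoℚ m * powℚ (1ℚ - frac 1 4 * ε * r) k →
      ℕtoℚ k ≤ℚ ℕtoℚ c * ((1ℚ + ε) * ρ)
counting-bound {ρ} {r} {ε} m k c N t 1≤ρ rρ≡1 0<ε ε≤1 1≤k tCρ m≤exp mwu = ≮⇒≥ (λ lt → absurd c lt ub)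
  where
  open ≤-Reasoning
  open +-*-Solver
  η = frac 1 4 * ε
  q = 1ℚ - η
  x = η * r
  -- `z = x - 2y`, where `2y` pays for the factor `m`; the first-order terms of
  -- `(1 + 2y)(1 - x)(1 + z)` then cancel.
  z = x * (1ℚ - η)
  -- Equal to `ε²/(32ρ)`, so that the exponent `t` is `k y`.
  y = frac 1 2 * (η * η * r)
  a = (1ℚ + ε) * ρ * z
  -- The leading excess of `q (1 + a)` over 1 is `η(ε - 2η) = 2η²` because `ε = 4η`; the loss `2η²ε`
  -- is absorbed in `2η²(1 - ε)`, which is nonnegative as `ε ≤ 1`.
  δ = η * η * ((1ℚ + 1ℚ) * (1ℚ - ε) + η + η * ε)
  0<1 : 0ℚ < 1ℚ
  0<1 = positive⁻¹ 1ℚ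
  0<ρ : 0ℚ < ρ
  0<ρ = <-≤-trans 0<1 1≤ρ
  0<r : 0ℚ < r
  0<r = *-cancelʳ-<-nonNeg ρ {{nonNegative (<⇒≤ 0<ρ)}} (subst₂ _<_ (sym (*-zeroˡ ρ)) (sym rρ≡1) 0<1)
  0≤r = <⇒≤ 0<r
  0<η : 0ℚ < η
  0<η = 0<* (positive⁻¹ (frac 1 4)) 0<ε
  0≤η = <⇒≤ 0<η
  0≤1-ε : 0ℚ ≤ℚ 1ℚ - ε
  0≤1-ε = p≤q⇒0≤q-p ε≤1
  0<q : 0ℚ < q
  0<q = subst (0ℚ <_) (lem ε)
          (+-mono-<-≤ (positive⁻¹ (frac 3 4)) (0≤* (nonNegative⁻¹ (frac 1 4)) 0≤1-ε))
    where
    lem : ∀ ε → frac 3 4 + frac 1 4 * (1ℚ - ε) ≡ 1ℚ - frac 1 4 * ε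
    lem = solve 1 (λ ε → con (frac 3 4) :+ con (frac 1 4) :* (con 1ℚ :- ε) := con 1ℚ :- con (frac 1 4) :* ε) refl
  0≤q = <⇒≤ 0<q
  r≤1 : r ≤ℚ 1ℚ
  r≤1 = subst₂ _≤ℚ_ (*-identityʳ r) rρ≡1 (*-monoˡ-≤-nonNeg r {{nonNegative 0≤r}} 1≤ρ)
  η≤1 : η ≤ℚ 1ℚ
  η≤1 = ≤-diff q 0≤q (lem η)
    where
    lem : ∀ η → η + (1ℚ - η) ≡ 1ℚ
    lem = solve 1 (λ η → η :+ (con 1ℚ :- η) := con 1ℚ) refl
  x≤1 : x ≤ℚ 1ℚ
  x≤1 = *-mono-≤ 0≤r 0≤1 η≤1 r≤1
  0≤x : 0ℚ ≤ℚ x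
  0≤x = 0≤* 0≤η 0≤r
  0≤1-x : 0ℚ ≤ℚ 1ℚ - x
  0≤1-x = p≤q⇒0≤q-p x≤1
  0<z : 0ℚ < z
  0<z = 0<* (0<* 0<η 0<r) 0<q
  0≤z = <⇒≤ 0<z
  0≤1+z = 0≤+ 0≤1 0≤z
  y+y : y + y ≡ η * η * r
  y+y = lem (η * η * r)
    where
    lem : ∀ p → frac 1 2 * p + frac 1 2 * p ≡ p
    lem = solve 1 (λ p → con (frac 1 2) :* p :+ con (frac 1 2) :* p := p) refl
  0≤y : 0ℚ ≤ℚ y
  0≤y = 0≤* (nonNegative⁻¹ (frac 1 2)) (0≤* (0≤* 0≤η 0≤η) 0≤r)
  2y≤1 : y + y ≤ℚ 1ℚ
  2y≤1 = subst (_≤ℚ 1ℚ) (sym y+y) (*-mono-≤ 0≤r 0≤1 (*-mono-≤ 0≤η 0≤1 η≤1 η≤1) r≤1)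
  t≡ky : t ≡ ℕtoℚ k * y
  t≡ky = begin-equality
    t                                          ≡⟨ *-identityʳ t ⟨
    t * 1ℚ                                     ≡⟨ cong (t *_) rρ≡1 ⟨
    t * (r * ρ)                                ≡⟨ lem₁ t r ρ ⟩
    t * (ℕtoℚ 32 * ρ) * (frac 1 32 * r)        ≡⟨ cong (_* (frac 1 32 * r)) tCρ ⟩
    ℕtoℚ k * ε * ε * (frac 1 32 * r)           ≡⟨ lem₂ (ℕtoℚ k) ε r ⟩
    ℕtoℚ k * y                                 ∎
    where
    lem₁ : ∀ t r ρ → t * (r * ρ) ≡ t * (ℕtoℚ 32 * ρ) * (frac 1 32 * r)
    lem₁ = solve 3 (λ t r ρ → t :* (r :* ρ) := t :* (con (ℕtoℚ 32) :* ρ) :* (con (frac 1 32) :* r)) refl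
    lem₂ : ∀ k ε r → k * ε * ε * (frac 1 32 * r) ≡ k * (frac 1 2 * (frac 1 4 * ε * (frac 1 4 * ε) * r))
    lem₂ = solve 3 (λ k ε r → k :* ε :* ε :* (con (frac 1 32) :* r) :=
             k :* (con (frac 1 2) :* (con (frac 1 4) :* ε :* (con (frac 1 4) :* ε) :* r))) refl
  m≤pow : ℕtoℚ m ≤ℚ powℚ (1ℚ + (y + y)) k
  m≤pow = ≤-trans m≤exp (subst (λ s → expPartial N s ≤ℚ powℚ (1ℚ + (y + y)) k) (sym t≡ky) (exp-≤-pow N 0≤y 2y≤1 k))

  contraction : (1ℚ + (y + y)) * (1ℚ - x) * (1ℚ + z) ≤ℚ 1ℚ
  contraction = ≤-diff (z * z + x * x * η * (1ℚ + z))
    (0≤+ (0≤* 0≤z 0≤z) (0≤* (0≤* (0≤* 0≤x 0≤x) 0≤η) 0≤1+z))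
    (trans (cong (λ s → (1ℚ + s) * (1ℚ - x) * (1ℚ + z) + (z * z + x * x * η * (1ℚ + z))) y+y) (lem η r))
    where
    lem : ∀ η r → (1ℚ + η * η * r) * (1ℚ - η * r) * (1ℚ + η * r * (1ℚ - η)) +
                    (η * r * (1ℚ - η) * (η * r * (1ℚ - η)) + η * r * (η * r) * η * (1ℚ + η * r * (1ℚ - η))) ≡ 1ℚ
    lem = solve 2 (λ η r → (con 1ℚ :+ η :* η :* r) :* (con 1ℚ :- η :* r) :* (con 1ℚ :+ η :* r :* (con 1ℚ :- η)) :+
                    (η :* r :* (con 1ℚ :- η) :* (η :* r :* (con 1ℚ :- η)) :+ η :* r :* (η :* r) :* η :*
                              (con 1ℚ :+ η :* r :* (con 1ℚ :- η))) := con 1ℚ) refl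

  ub : powℚ q c * powℚ (1ℚ + z) k ≤ℚ 1ℚ
  ub = begin
    powℚ q c * powℚ (1ℚ + z) k
      ≤⟨ *-monoʳ-≤-nonNeg (powℚ (1ℚ + z) k) {{nonNegative 0≤Zk}}
           (≤-trans mwu (*-monoʳ-≤-nonNeg (powℚ (1ℚ - x) k) {{nonNegative (0≤powℚ 0≤1-x k)}} m≤pow)) ⟩
    powℚ (1ℚ + (y + y)) k * powℚ (1ℚ - x) k * powℚ (1ℚ + z) k
      ≡⟨ cong (_* powℚ (1ℚ + z) k) (powℚ-* (1ℚ + (y + y)) (1ℚ - x) k) ⟨
    powℚ ((1ℚ + (y + y)) * (1ℚ - x)) k * powℚ (1ℚ + z) k
      ≡⟨ powℚ-* ((1ℚ + (y + y)) * (1ℚ - x)) (1ℚ + z) k ⟨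
    powℚ ((1ℚ + (y + y)) * (1ℚ - x) * (1ℚ + z)) k
      ≤⟨ powℚ-≤1 (0≤* (0≤* (0≤+ 0≤1 (0≤+ 0≤y 0≤y)) 0≤1-x) 0≤1+z) contraction k ⟩
    1ℚ ∎
    where
    0≤Zk : 0ℚ ≤ℚ powℚ (1ℚ + z) k
    0≤Zk = 0≤powℚ 0≤1+z k

  expansion : q * (1ℚ + a) ≡ 1ℚ + δ
  expansion = trans (lem₁ ε r ρ) (trans (cong (λ s → (1ℚ - frac 1 4 * ε) * (1ℚ + (1ℚ + ε) * (frac 1 4 * ε) *
            (1ℚ - frac 1 4 * ε) * s)) rρ≡1) (lem₂ ε))
    where
    lem₁ : ∀ ε r ρ → (1ℚ - frac 1 4 * ε) * (1ℚ + (1ℚ + ε) * ρ * (frac 1 4 * ε * r * (1ℚ - frac 1 4 * ε))) ≡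
             (1ℚ - frac 1 4 * ε) * (1ℚ + (1ℚ + ε) * (frac 1 4 * ε) * (1ℚ - frac 1 4 * ε) * (r * ρ))
    lem₁ = solve 3 (λ ε r ρ → (con 1ℚ :- con (frac 1 4) :* ε) :* (con 1ℚ :+ (con 1ℚ :+ ε) :* ρ :* (con
              (frac 1 4) :* ε :* r :* (con 1ℚ :- con (frac 1 4) :* ε))) :=
             (con 1ℚ :- con (frac 1 4) :* ε) :* (con 1ℚ :+ (con 1ℚ :+ ε) :* (con (frac 1 4) :* ε) :*
                       (con 1ℚ :- con (frac 1 4) :* ε) :* (r :* ρ))) refl
    lem₂ : ∀ ε → (1ℚ - frac 1 4 * ε) * (1ℚ + (1ℚ + ε) * (frac 1 4 * ε) * (1ℚ - frac 1 4 * ε) * 1ℚ) ≡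
             1ℚ + frac 1 4 * ε * (frac 1 4 * ε) * ((1ℚ + 1ℚ) * (1ℚ - ε) + frac 1 4 * ε + frac 1 4 * ε * ε)
    lem₂ = solve 1 (λ ε → (con 1ℚ :- con (frac 1 4) :* ε) :* (con 1ℚ :+ (con 1ℚ :+ ε) :* (con
              (frac 1 4) :* ε) :* (con 1ℚ :- con (frac 1 4) :* ε) :* con 1ℚ) :=
             con 1ℚ :+ con (frac 1 4) :* ε :* (con (frac 1 4) :* ε) :* ((con 1ℚ :+ con 1ℚ) :* (con 1ℚ :- ε)
                       :+ con (frac 1 4) :* ε :+ con (frac 1 4) :* ε :* ε)) refl

  0<δ : 0ℚ < δ
  0<δ = 0<* (0<* 0<η 0<η)
    (+-mono-<-≤ (+-mono-≤-< (0≤* (0≤+ 0≤1 0≤1) 0≤1-ε) 0<η) (0≤* 0≤η (<⇒≤ 0<ε)))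

  1≤[1+ε]ρ : 1ℚ ≤ℚ (1ℚ + ε) * ρ
  1≤[1+ε]ρ = *-mono-≤ 0≤1 (0≤+ 0≤1 (<⇒≤ 0<ε)) (≤-diff ε (<⇒≤ 0<ε) refl) 1≤ρ

  0≤a : 0ℚ ≤ℚ a
  0≤a = 0≤* (≤-trans 0≤1 1≤[1+ε]ρ) 0≤z

  -- AM-GM for `c + 1` copies of `1 + a` and `k - (c + 1)` copies of 1: their sum is
  -- `k + (c+1)(1+ε)ρz ≤ k(1 + z)`. The number of ones is legitimate because `(1 + ε)ρ ≥ 1`.
  pow-comparison : ∀ c → ℕtoℚ (suc c) * ((1ℚ + ε) * ρ) < ℕtoℚ k → powℚ (1ℚ + a) (suc c) ≤ℚ powℚ (1ℚ + z) k
  pow-comparison c lt = subst (λ n → powℚ (1ℚ + a) (suc c) ≤ℚ powℚ (1ℚ + z) n) d+c≡k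
      (am-gm c (0≤+ 0≤1 0≤a) d 0≤1+z
        (≤-diff ((ℕtoℚ k - S * ((1ℚ + ε) * ρ)) * z) (0≤* (p≤q⇒0≤q-p (<⇒≤ lt)) 0≤z)
          (trans (lem S (ℕtoℚ d) (ℕtoℚ k) ((1ℚ + ε) * ρ) z)
            (trans (cong₂ (λ s s′ → s + s′ * z) (sym ℕtoℚ-d+c) (cong ℕtoℚ (sym d+c≡k))) (lem₃ (ℕtoℚ
                      (d ℕ.+ suc c)) z)))))
    where
    S = ℕtoℚ (suc c)
    c≤k : suc c ℕ.≤ k
    c≤k = ℕP.≮⇒≥ (λ k<c → <⇒≱ lt (≤-trans (ℕtoℚ-mono-≤ (ℕP.<⇒≤ k<c))
            (subst (_≤ℚ S * ((1ℚ + ε) * ρ)) (*-identityʳ S) (*-monoˡ-≤-nonNeg S {{nonNegative (0≤ℕtoℚ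
                      (suc c))}} 1≤[1+ε]ρ))))
    d = k ℕ.∸ suc c
    d+c≡k : d ℕ.+ suc c ≡ k
    d+c≡k = ℕP.m∸n+n≡m c≤k
    ℕtoℚ-d+c : ℕtoℚ (d ℕ.+ suc c) ≡ S + ℕtoℚ d
    ℕtoℚ-d+c = trans (ℕtoℚ-+ d (suc c)) (+-comm (ℕtoℚ d) S)
    lem : ∀ S d k b z → S * (1ℚ + b * z) + d + (k - S * b) * z ≡ (S + d) + k * z
    lem = solve 5 (λ S d k b z → S :* (con 1ℚ :+ b :* z) :+ d :+ (k :- S :* b) :* z := (S :+ d) :+ k :* z) refl
    lem₃ : ∀ k z → k + k * z ≡ k * (1ℚ + z)
    lem₃ = solve 2 (λ k z → k :+ k :* z := k :* (con 1ℚ :+ z)) refl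

  absurd : ∀ c → ℕtoℚ c * ((1ℚ + ε) * ρ) < ℕtoℚ k → powℚ q c * powℚ (1ℚ + z) k ≤ℚ 1ℚ → ⊥
  -- For `c = 0` no factor `1 + δ` is available; here the contradiction is `1 < (1 + z)^k`, from
  -- `1 ≤ k`.
  absurd zero lt le = <⇒≱ (1<Zk k 1≤k) (subst (_≤ℚ 1ℚ) (*-identityˡ (powℚ (1ℚ + z) k)) le)
    where
    1<Zk : ∀ k → 1 ℕ.≤ k → 1ℚ < powℚ (1ℚ + z) k
    1<Zk (suc k) _ = 1<pow 0<z k
  absurd (suc c) lt le = <⇒≱ (1<pow 0<δ c) (begin
    powℚ (1ℚ + δ) (suc c)                   ≡⟨ cong (λ s → powℚ s (suc c)) expansion ⟨
    powℚ (q * (1ℚ + a)) (suc c)             ≡⟨ powℚ-* q (1ℚ + a) (suc c) ⟩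
    powℚ q (suc c) * powℚ (1ℚ + a) (suc c)  ≤⟨ *-monoˡ-≤-nonNeg (powℚ q (suc c)) {{nonNegative (0≤powℚ 0≤q (suc c))}}
                                                 (pow-comparison c lt) ⟩
    powℚ q (suc c) * powℚ (1ℚ + z) k        ≤⟨ le ⟩
    1ℚ                                      ∎)

-- Finite sums of rationals

sumℚ-cong : ∀ {n} {f g : Fin n → ℚ} → (∀ i → f i ≡ g i) → sumℚ f ≡ sumℚ g
sumℚ-cong {zero}  eq = refl
sumℚ-cong {suc n} eq = cong₂ _+_ (eq Fin.zero) (sumℚ-cong (λ i → eq (Fin.suc i)))

sumℚ-mono : ∀ {n} {f g : Fin n → ℚ} → (∀ i → f i ≤ℚ g i) → sumℚ f ≤ℚ sumℚ g
sumℚ-mono {zero}  le = ≤-refl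
sumℚ-mono {suc n} le = +-mono-≤ (le Fin.zero) (sumℚ-mono (λ i → le (Fin.suc i)))

sumℚ-+ : ∀ {n} (f g : Fin n → ℚ) → sumℚ (λ i → f i + g i) ≡ sumℚ f + sumℚ g
sumℚ-+ {zero}  f g = refl
sumℚ-+ {suc n} f g = trans (cong (f Fin.zero + g Fin.zero +_) (sumℚ-+ (λ i → f (Fin.suc i)) (λ i → g (Fin.suc i))))
    (lem (f Fin.zero) (g Fin.zero) _ _)
  where
  open +-*-Solver
  lem : ∀ a b c d → a + b + (c + d) ≡ a + c + (b + d)
  lem = solve 4 (λ a b c d → a :+ b :+ (c :+ d) := a :+ c :+ (b :+ d)) refl

sumℚ-*ˡ : ∀ {n} (p : ℚ) (f : Fin n → ℚ) → sumℚ (λ i → p * f i) ≡ p * sumℚ f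
sumℚ-*ˡ {zero}  p f = sym (*-zeroʳ p)
sumℚ-*ˡ {suc n} p f = trans (cong (p * f Fin.zero +_) (sumℚ-*ˡ p (λ i → f (Fin.suc i)))) (sym (*-distribˡ-+ p
          (f Fin.zero) (sumℚ (λ i → f (Fin.suc i)))))

sumℚ-linear : ∀ {n} (h f g : Fin n → ℚ) p → (∀ i → h i ≡ f i + p * g i) → sumℚ h ≡ sumℚ f + p * sumℚ g
sumℚ-linear h f g p eq = trans (sumℚ-cong eq)
  (trans (sumℚ-+ f (λ i → p * g i)) (cong (sumℚ f +_) (sumℚ-*ˡ p g)))

sumℚ-nonneg : ∀ {n} {f : Fin n → ℚ} → (∀ i → 0ℚ ≤ℚ f i) → 0ℚ ≤ℚ sumℚ f
sumℚ-nonneg {zero}  le = ≤-refl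
sumℚ-nonneg {suc n} le = 0≤+ (le Fin.zero) (sumℚ-nonneg (λ i → le (Fin.suc i)))

term≤sumℚ : ∀ {n} {f : Fin n → ℚ} → (∀ i → 0ℚ ≤ℚ f i) → ∀ i → f i ≤ℚ sumℚ f
term≤sumℚ {suc n} {f} le Fin.zero    = ≤-diff _ (sumℚ-nonneg (λ i → le (Fin.suc i))) refl
term≤sumℚ {suc n} {f} le (Fin.suc i) = ≤-trans (term≤sumℚ (λ i → le (Fin.suc i)) i)
  (≤-diff (f Fin.zero) (le Fin.zero) (+-comm _ (f Fin.zero)))

sumℚ-ℕtoℚ : ∀ {n} (f : Fin n → ℕ) → sumℚ (λ i → ℕtoℚ (f i)) ≡ ℕtoℚ (sumℕ f)
sumℚ-ℕtoℚ {zero}  f = refl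
sumℚ-ℕtoℚ {suc n} f = trans (cong (ℕtoℚ (f Fin.zero) +_) (sumℚ-ℕtoℚ (λ i → f (Fin.suc i))))
  (sym (ℕtoℚ-+ (f Fin.zero) (sumℕ (λ i → f (Fin.suc i)))))

sumℚ-1 : ∀ n → sumℚ {n} (λ _ → 1ℚ) ≡ ℕtoℚ n
sumℚ-1 zero    = refl
sumℚ-1 (suc n) = trans (cong (1ℚ +_) (sumℚ-1 n)) (sym (ℕtoℚ-suc n))

-- The multiplicative-weights potential

indicator : Bool → ℕ
indicator b = if b then 1 else 0

-- The payoff of an edge, centred at the break-even rate `1/ρ`: a set `F` has nonnegative total gain
-- exactly when `|F| ≤ ρ |P ∩ F|`.
gain : ℚ → Bool → ℚ
gain ρ b = ρ * ℕtoℚ (indicator b) - 1ℚ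

sum-gain : ∀ {n} ρ (F P : Fin n → Bool) →
  sumℚ (λ e → if F e then gain ρ (P e) else 0ℚ) ≡ ρ * ℕtoℚ (count (λ e → P e ∧ F e)) - ℕtoℚ (count F)
sum-gain {zero} ρ F P = sym (cong (_+ 0ℚ) (*-zeroʳ ρ))
sum-gain {suc n} ρ F P =
  trans (cong ((if F Fin.zero then gain ρ (P Fin.zero) else 0ℚ) +_) (sum-gain ρ F′ P′))
    (trans (head (F Fin.zero) (P Fin.zero) (ℕtoℚ (count (λ e → P′ e ∧ F′ e))) (ℕtoℚ (count F′)))
      (sym (cong₂ (λ s s′ → ρ * s - s′)
        (ℕtoℚ-+ (indicator (P Fin.zero ∧ F Fin.zero)) (count (λ e → P′ e ∧ F′ e)))
        (ℕtoℚ-+ (indicator (F Fin.zero)) (count F′)))))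
  where
  F′ P′ : Fin n → Bool
  F′ e = F (Fin.suc e)
  P′ e = P (Fin.suc e)
  open +-*-Solver
  lem : ∀ ρ i a b → ρ * i - 1ℚ + (ρ * a - b) ≡ ρ * (i + a) - (1ℚ + b)
  lem = solve 4 (λ ρ i a b → ρ :* i :- con 1ℚ :+ (ρ :* a :- b) := ρ :* (i :+ a) :- (con 1ℚ :+ b)) refl
  lem₀ : ∀ ρ a b → 0ℚ + (ρ * a - b) ≡ ρ * (0ℚ + a) - (0ℚ + b)
  lem₀ = solve 3 (λ ρ a b → con 0ℚ :+ (ρ :* a :- b) := ρ :* (con 0ℚ :+ a) :- (con 0ℚ :+ b)) refl
  head : ∀ f p a b → (if f then gain ρ p else 0ℚ) + (ρ * a - b) ≡
           ρ * (ℕtoℚ (indicator (p ∧ f)) + a) - (ℕtoℚ (indicator f) + b)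
  head true  true  a b = lem ρ 1ℚ a b
  head true  false a b = lem ρ 0ℚ a b
  head false true  a b = lem₀ ρ a b
  head false false a b = lem₀ ρ a b

≤ᵇ-true : ∀ {a b} → a ℕ.≤ b → (a ℕ.≤ᵇ b) ≡ true
≤ᵇ-true {a} {b} a≤b with a ℕ.≤ᵇ b | ℕP.≤⇒≤ᵇ a≤b
... | true | _ = refl

≤ᵇ-false : ∀ {a b} → b ℕ.< a → (a ℕ.≤ᵇ b) ≡ false
≤ᵇ-false {a} {b} b<a with a ℕ.≤ᵇ b in eq
... | false = refl
... | true  = ⊥-elim (ℕP.<⇒≱ b<a (ℕP.≤ᵇ⇒≤ a b (subst T (sym eq) tt)))

-- Abel summation: qᶜ is a nonnegative combination of the threshold functions [c ≤ t].
abel : ∀ {n q} → 0ℚ ≤ℚ q → q ≤ℚ 1ℚ → (v : Fin n → ℚ) (c : Fin n → ℕ) (M : ℕ) → (∀ e → c e ℕ.≤ M) →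
       (∀ t → 0ℚ ≤ℚ sumℚ (λ e → if c e ℕ.≤ᵇ t then v e else 0ℚ)) →
       0ℚ ≤ℚ sumℚ (λ e → powℚ q (c e) * v e)
abel {n} {q} 0≤q q≤1 v c M c≤M levels =
  subst (0ℚ ≤ℚ_) (sym split) (0≤+ (layers M) (0≤* (0≤powℚ 0≤q M) 0≤Σv))
  where
  open +-*-Solver
  -- A telescoping sum equal to `q^a - q^t` for `a ≤ t`. The remaining constant `q^M` multiplies the
  -- full sum, which is the level set at `M`.
  layer : ℕ → ℕ → ℚ
  layer zero    a = 0ℚ
  layer (suc t) a = layer t a + (if a ℕ.≤ᵇ t then powℚ q t - powℚ q (suc t) else 0ℚ)

  layer-above : ∀ t a → t ℕ.≤ a → layer t a ≡ 0ℚ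
  layer-above zero    a _   = refl
  layer-above (suc t) a t<a rewrite layer-above t a (ℕP.<⇒≤ t<a) | ≤ᵇ-false t<a = refl

  layer-below : ∀ t a → a ℕ.≤ t → layer t a ≡ powℚ q a - powℚ q t
  layer-below zero    zero    _   = refl
  layer-below (suc t) a a≤1+t with ℕP.m≤n⇒m<n∨m≡n a≤1+t
  ... | inj₂ refl = trans (layer-above (suc t) a ℕP.≤-refl) (sym (+-inverseʳ (powℚ q a)))
  ... | inj₁ (ℕ.s≤s a≤t) rewrite layer-below t a a≤t | ≤ᵇ-true a≤t = lem (powℚ q a) (powℚ q t) (powℚ q (suc t))
    where
    lem : ∀ x y z → x - y + (y - z) ≡ x - z
    lem = solve 3 (λ x y z → x :- y :+ (y :- z) := x :- z) refl

  0≤step : ∀ t → 0ℚ ≤ℚ powℚ q t - powℚ q (suc t)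
  0≤step t = p≤q⇒0≤q-p (subst (powℚ q (suc t) ≤ℚ_) (*-identityˡ (powℚ q t))
    (*-monoʳ-≤-nonNeg (powℚ q t) {{nonNegative (0≤powℚ 0≤q t)}} q≤1))

  layers : ∀ t → 0ℚ ≤ℚ sumℚ (λ e → layer t (c e) * v e)
  layers zero    = sumℚ-nonneg (λ e → ≤-reflexive (sym (*-zeroˡ (v e))))
  layers (suc t) = subst (0ℚ ≤ℚ_)
      (sym (sumℚ-linear (λ e → layer (suc t) (c e) * v e) (λ e → layer t (c e) * v e)
        (λ e → if c e ℕ.≤ᵇ t then v e else 0ℚ) d (λ e → lem (layer t (c e)) (c e ℕ.≤ᵇ t) (v e))))
      (0≤+ (layers t) (0≤* (0≤step t) (levels t)))
    where
    d = powℚ q t - powℚ q (suc t)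
    lem : ∀ l b w → (l + (if b then d else 0ℚ)) * w ≡ l * w + d * (if b then w else 0ℚ)
    lem l true  w = *-distribʳ-+ w l d
    lem l false w = trans (*-distribʳ-+ w l 0ℚ) (cong (l * w +_) (trans (*-zeroˡ w) (sym (*-zeroʳ d))))

  0≤Σv : 0ℚ ≤ℚ sumℚ v
  0≤Σv = subst (0ℚ ≤ℚ_) (sumℚ-cong (λ e → cong (if_then v e else 0ℚ) (≤ᵇ-true (c≤M e)))) (levels M)

  split : sumℚ (λ e → powℚ q (c e) * v e) ≡ sumℚ (λ e → layer M (c e) * v e) + powℚ q M * sumℚ v
  split = sumℚ-linear (λ e → powℚ q (c e) * v e) (λ e → layer M (c e) * v e) v (powℚ q M) eq
    where
    lem : ∀ x y w → x * w ≡ (x - y) * w + y * w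
    lem = solve 3 (λ x y w → x :* w := (x :- y) :* w :+ y :* w) refl
    eq : ∀ e → powℚ q (c e) * v e ≡ layer M (c e) * v e + powℚ q M * v e
    eq e rewrite layer-below M (c e) (c≤M e) = lem (powℚ q (c e)) (powℚ q M) (v e)

-- Since `rρ = 1`, the equation `q^c′ + ηr q^c gain = (1 - ηr) q^c` holds exactly for every edge,
-- chosen or not. The claim thus reduces to a nonnegative weighted total gain.
potential-step : ∀ {n ρ r η} → 0ℚ ≤ℚ r → r * ρ ≡ 1ℚ → 0ℚ ≤ℚ η → η ≤ℚ 1ℚ →
  (P : Fin n → Bool) (c c′ : Fin n → ℕ) → (∀ e → c′ e ≡ c e ℕ.+ indicator (P e)) →
  (M : ℕ) → (∀ e → c e ℕ.≤ M) →
  (∀ t → ℕtoℚ (count (λ e → c e ℕ.≤ᵇ t)) ≤ℚ ρ * ℕtoℚ (count (λ e → P e ∧ (c e ℕ.≤ᵇ t)))) →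
  sumℚ (λ e → powℚ (1ℚ - η) (c′ e)) ≤ℚ (1ℚ - η * r) * sumℚ (λ e → powℚ (1ℚ - η) (c e))
potential-step {n} {ρ} {r} {η} 0≤r rρ≡1 0≤η η≤1 P c c′ c′≡ M c≤M levels =
  ≤-diff (η * r * sumℚ (λ e → powℚ q (c e) * gain ρ (P e))) (0≤* (0≤* 0≤η 0≤r) 0≤Σ)
    (sym (trans (sym (sumℚ-*ˡ (1ℚ - η * r) (λ e → powℚ q (c e))))
      (sumℚ-linear (λ e → (1ℚ - η * r) * powℚ q (c e)) (λ e → powℚ q (c′ e))
        (λ e → powℚ q (c e) * gain ρ (P e)) (η * r) (λ e → sym (eq e)))))
  where
  open +-*-Solver
  q = 1ℚ - η
  q≤1 : q ≤ℚ 1ℚ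
  q≤1 = ≤-diff η 0≤η (solve 1 (λ η → con 1ℚ :- η :+ η := con 1ℚ) refl η)
  0≤Σ : 0ℚ ≤ℚ sumℚ (λ e → powℚ q (c e) * gain ρ (P e))
  0≤Σ = abel (p≤q⇒0≤q-p η≤1) q≤1 (λ e → gain ρ (P e)) c M c≤M
    (λ t → subst (0ℚ ≤ℚ_) (sym (sum-gain ρ (λ e → c e ℕ.≤ᵇ t) P)) (p≤q⇒0≤q-p (levels t)))
  lem : ∀ η r ρ Q → (1ℚ - η) * Q + η * r * (Q * (ρ * 1ℚ - 1ℚ)) ≡ (1ℚ - η * r) * Q + η * Q * (r * ρ - 1ℚ)
  lem = solve 4 (λ η r ρ Q → (con 1ℚ :- η) :* Q :+ η :* r :* (Q :* (ρ :* con 1ℚ :- con 1ℚ)) :=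
          (con 1ℚ :- η :* r) :* Q :+ η :* Q :* (r :* ρ :- con 1ℚ)) refl
  lem₀ : ∀ η r ρ Q → Q + η * r * (Q * (ρ * 0ℚ - 1ℚ)) ≡ (1ℚ - η * r) * Q
  lem₀ = solve 4 (λ η r ρ Q → Q :+ η :* r :* (Q :* (ρ :* con 0ℚ :- con 1ℚ)) := (con 1ℚ :- η :* r) :* Q) refl
  eq : ∀ e → powℚ q (c′ e) + η * r * (powℚ q (c e) * gain ρ (P e)) ≡ (1ℚ - η * r) * powℚ q (c e)
  eq e with P e | c′≡ e
  ... | true  | c′e rewrite c′e | ℕP.+-comm (c e) 1 =
    trans (lem η r ρ (powℚ q (c e)))
      (trans (cong (λ s → (1ℚ - η * r) * powℚ q (c e) + η * powℚ q (c e) * (s - 1ℚ)) rρ≡1)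
        (trans (cong ((1ℚ - η * r) * powℚ q (c e) +_) (*-zeroʳ (η * powℚ q (c e)))) (+-identityʳ _)))
  ... | false | c′e rewrite c′e | ℕP.+-identityʳ (c e) = lem₀ η r ρ (powℚ q (c e))

-- Cycles, walks and injective assignments

true≢false : ∀ {b} → b ≡ true → b ≡ false → ⊥
true≢false refl ()

≢true⇒false : ∀ {b} → b ≢ true → b ≡ false
≢true⇒false {true}  ne = ⊥-elim (ne refl)
≢true⇒false {false} ne = refl

module _ (G : Multigraph) where
  open Multigraph G

  next-inject₁ : ∀ {k} (i : Fin k) → next G (inject₁ i) ≡ Fin.suc i
  next-inject₁ Fin.zero = refl
  next-inject₁ (Fin.suc i) rewrite next-inject₁ i = refl

  next-fromℕ : ∀ k → next G (fromℕ k) ≡ Fin.zero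
  next-fromℕ zero = refl
  next-fromℕ (suc k) rewrite next-fromℕ k = refl

  next-surjective : ∀ {k} (j : Fin (suc k)) → ∃ λ i → next G i ≡ j
  next-surjective {k} Fin.zero    = fromℕ k , next-fromℕ k
  next-surjective {k} (Fin.suc i) = inject₁ i , next-inject₁ i

  next-injective : ∀ {k} (i j : Fin (suc k)) → next G i ≡ next G j → i ≡ j
  next-injective i j eq with view i | view j
  ... | ‵fromℕ      | ‵fromℕ      = refl
  ... | ‵fromℕ      | ‵inject₁ j′ with () ← trans (sym (next-fromℕ _)) (trans eq (next-inject₁ j′))
  ... | ‵inject₁ i′ | ‵fromℕ      with () ← trans (sym (next-fromℕ _)) (trans (sym eq) (next-inject₁ i′))
  ... | ‵inject₁ i′ | ‵inject₁ j′ =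
    cong inject₁ (FinP.suc-injective (trans (sym (next-inject₁ i′)) (trans eq (next-inject₁ j′))))

  next-induction : ∀ {k} (Q : Fin (suc k) → Set) → (∀ j → Q j → Q (next G j)) → ∀ i → Q i → ∀ j → Q j
  next-induction {k} Q up i qi = <-weakInduction Q (subst Q (next-fromℕ k) (up _ q-last))
      (λ j q → subst Q (next-inject₁ j) (up _ q))
    where
    q-last : Q (fromℕ k)
    q-last = >-weakInduction (λ j → Q j → Q (fromℕ k)) (λ q → q)
               (λ j ih q → ih (subst Q (next-inject₁ j) (up _ q))) i qi

  next-coinduction : ∀ {k} (Q : Fin (suc k) → Set) → (∀ j → Q (next G j) → Q j) → ∀ i → Q i → ∀ j → Q j
  next-coinduction {k} Q down i qi = >-weakInduction Q (down _ (subst Q (sym (next-fromℕ k)) q-zero))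
      (λ j q → down _ (subst Q (sym (next-inject₁ j)) q))
    where
    q-zero : Q Fin.zero
    q-zero = <-weakInduction (λ j → Q j → Q Fin.zero) (λ q → q)
               (λ j ih q → ih (down _ (subst Q (sym (next-inject₁ j)) q))) i qi

  joins-sym : ∀ {e u v} → Joins G e u v → Joins G e v u
  joins-sym (inj₁ p) = inj₂ p
  joins-sym (inj₂ p) = inj₁ p

  joins-unique : ∀ {e u v x y} → Joins G e u v → Joins G e x y → (x ≡ u × y ≡ v) ⊎ (x ≡ v × y ≡ u)
  joins-unique (inj₁ p) (inj₁ q) with refl ← trans (sym p) q = inj₁ (refl , refl)
  joins-unique (inj₁ p) (inj₂ q) with refl ← trans (sym p) q = inj₂ (refl , refl)
  joins-unique (inj₂ p) (inj₁ q) with refl ← trans (sym p) q = inj₂ (refl , refl)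
  joins-unique (inj₂ p) (inj₂ q) with refl ← trans (sym p) q = inj₁ (refl , refl)

  joins-ends : ∀ e → Joins G e (proj₁ (ends e)) (proj₂ (ends e))
  joins-ends e = inj₁ refl

  _⊆_ : EdgeSet G → EdgeSet G → Set
  P ⊆ Q = ∀ e → P e ≡ true → Q e ≡ true

  walk-mono : ∀ {P Q u v l} → P ⊆ Q → Walk G P u v l → Walk G Q u v l
  walk-mono P⊆Q nil = nil
  walk-mono P⊆Q (step e Pe uw W) = step e (P⊆Q e Pe) uw (walk-mono P⊆Q W)

  walk-++ : ∀ {P u v w l l′} → Walk G P u v l → Walk G P v w l′ → Walk G P u w (l ℕ.+ l′)
  walk-++ nil W′ = W′
  walk-++ (step e Pe uw W) W′ = step e Pe uw (walk-++ W W′)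

  connected-refl : ∀ {P u} → Connected G P u u
  connected-refl = 0 , nil

  connected-trans : ∀ {P u v w} → Connected G P u v → Connected G P v w → Connected G P u w
  connected-trans (l , W) (l′ , W′) = l ℕ.+ l′ , walk-++ W W′

  connected-edge : ∀ {P u v} e → P e ≡ true → Joins G e u v → Connected G P u v
  connected-edge e Pe uv = 1 , step e Pe uv nil

  connected-sym : ∀ {P u v} → Connected G P u v → Connected G P v u
  connected-sym (_ , nil) = connected-refl
  connected-sym (suc l , step e Pe uw W) =
    connected-trans (connected-sym (l , W)) (connected-edge e Pe (joins-sym uw))

  connected-mono : ∀ {P Q u v} → P ⊆ Q → Connected G P u v → Connected G Q u v
  connected-mono P⊆Q (l , W) = l , walk-mono P⊆Q W

  cycle-mono : ∀ {P Q} → P ⊆ Q → Cycle G P → Cycle G Q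
  cycle-mono P⊆Q Z = record
    { len = len; vs = vs; es = es; vs-inj = vs-inj; es-inj = es-inj
    ; es-in = λ j → P⊆Q _ (es-in j); es-join = es-join }
    where open Cycle Z

  OnCycle : ∀ {P} → Cycle G P → Vertex G → Set
  OnCycle Z v = ∃ λ j → Cycle.vs Z j ≡ v

  inCycle? : ∀ {P} (Z : Cycle G P) e → Dec (InCycle G Z e)
  inCycle? Z e = FinP.any? (λ j → Cycle.es Z j FinP.≟ e)

  inCycle-ends : ∀ {P} (Z : Cycle G P) {e u v} → InCycle G Z e → Joins G e u v → OnCycle Z u × OnCycle Z v
  inCycle-ends Z (j , refl) uv with joins-unique (Cycle.es-join Z j) uv
  ... | inj₁ (refl , refl) = (j , refl) , (next G j , refl)
  ... | inj₂ (refl , refl) = (next G j , refl) , (j , refl)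

  cycle-connected : ∀ {P} (Z : Cycle G P) → ∀ i j → Connected G P (Cycle.vs Z i) (Cycle.vs Z j)
  cycle-connected Z i = next-induction (λ j → Connected G _ (vs i) (vs j))
      (λ j c → connected-trans c (connected-edge (es j) (es-in j) (es-join j))) i connected-refl
    where open Cycle Z

  record Assignment (P : EdgeSet G) (h : Edge G → Vertex G) : Set where
    field
      joins     : ∀ e → P e ≡ true → ∃ λ w → Joins G e (h e) w
      injective : ∀ e f → P e ≡ true → P f ≡ true → h e ≡ h f → e ≡ f

    endpoint : ∀ {e u v} → P e ≡ true → Joins G e u v → h e ≡ u ⊎ h e ≡ v
    endpoint {e} Pe uv with joins e Pe
    ... | w , ew with joins-unique uv ew
    ... | inj₁ (p , _) = inj₁ p
    ... | inj₂ (p , _) = inj₂ p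

  Free : EdgeSet G → (Edge G → Vertex G) → Vertex G → Set
  Free P h v = ∀ e → P e ≡ true → h e ≢ v

  saturated-or-free : ∀ P h v → (∃ λ e → P e ≡ true × h e ≡ v) ⊎ Free P h v
  saturated-or-free P h v with FinP.any? (λ e → (P e ≟ᵇ true) ×-dec (h e FinP.≟ v))
  ... | yes s = inj₁ s
  ... | no ns = inj₂ (λ e Pe he → ns (e , Pe , he))

  -- Leaving every vertex along the edge assigned to it leads from v into X.
  data Reach (P : EdgeSet G) (h : Edge G → Vertex G) (X : Vertex G → Set) : Vertex G → Set where
    here  : ∀ {v} → X v → Reach P h X v
    there : ∀ {v w} e → P e ≡ true → h e ≡ v → Joins G e v w → Reach P h X w → Reach P h X v

  -- A trap for paths that leave vertices along assigned edges. Its instances are the vertex set of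
  -- a cycle and a single free root, for which the condition is vacuous.
  Closed : EdgeSet G → (Edge G → Vertex G) → (Vertex G → Set) → Set
  Closed P h X = ∀ {e w} → P e ≡ true → X (h e) → Joins G e (h e) w → X w

  module _ {P : EdgeSet G} {h : Edge G → Vertex G} (A : Assignment P h) where
    open Assignment A

    -- An edge assigned to `y` can be prepended to the path. An edge assigned to `x` is, by
    -- injectivity, the one by which the path leaves `x`, so the rest of the path starts at `y`; if
    -- the path has already ended at `x`, closedness puts `y` in `X`.
    reach-edge : ∀ {X} → Closed P h X → ∀ {e x y} → P e ≡ true → Joins G e x y → Reach P h X x → Reach P h X y
    reach-edge cl {e} Pe xy r with endpoint Pe xy
    ... | inj₂ he≡y = there e Pe he≡y (joins-sym xy) r
    ... | inj₁ refl with r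
    ... | here x∈X = here (cl Pe x∈X xy)
    ... | there f Pf hf≡x fw r′ with refl ← injective f e Pf Pe hf≡x | joins-unique xy fw
    ... | inj₁ (_ , refl) = r′
    ... | inj₂ (refl , refl) = r′

    reach-walk : ∀ {X} → Closed P h X → ∀ {x y l} → Walk G P x y l → Reach P h X x → Reach P h X y
    reach-walk cl nil r = r
    reach-walk cl (step e Pe xw W) r = reach-walk cl W (reach-edge cl Pe xw r)

    reach-closed : ∀ {X Y} → Closed P h Y → ∀ {v} → Y v → Reach P h X v → ∃ λ w → Y w × X w
    reach-closed cl y (here x) = _ , y , x
    reach-closed cl y (there e Pe refl vw r) = reach-closed cl (cl Pe y vw) r

    -- Once an edge is assigned to its far end, the following edge finds that vertex taken and is
    -- assigned to its own far end; this propagates around the cycle.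
    cycle-orientation : (Z : Cycle G P) → let open Cycle Z in
                        (∀ j → h (es j) ≡ vs j) ⊎ (∀ j → h (es j) ≡ vs (next G j))
    cycle-orientation Z with FinP.any? (λ j → h (es j) FinP.≟ vs (next G j))
      where open Cycle Z
    ... | yes (i , hi) = inj₂ (next-induction (λ j → h (es j) ≡ vs (next G j)) turn i hi)
      where
      open Cycle Z
      turn : ∀ j → h (es j) ≡ vs (next G j) → h (es (next G j)) ≡ vs (next G (next G j))
      turn j hj with endpoint (es-in (next G j)) (es-join (next G j))
      ... | inj₂ p = p
      -- Consecutive edges assigned to the same vertex coincide, so the cycle is a loop.
      ... | inj₁ p = trans (cong (λ i → h (es i)) loop) (trans hj (cong (λ i → vs (next G i)) (sym loop)))
        where
        loop : next G j ≡ j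
        loop = es-inj (injective _ _ (es-in _) (es-in _) (trans p (sym hj)))
    ... | no none = inj₁ forward
      where
      open Cycle Z
      forward : ∀ j → h (es j) ≡ vs j
      forward j with endpoint (es-in j) (es-join j)
      ... | inj₁ p = p
      ... | inj₂ p = ⊥-elim (none (j , p))

    cycle-saturated : (Z : Cycle G P) → ∀ {e} → P e ≡ true → OnCycle Z (h e) → InCycle G Z e
    cycle-saturated Z {e} Pe (j , vj≡he) with cycle-orientation Z
    ... | inj₁ fwd = j , injective _ _ (Cycle.es-in Z j) Pe (trans (fwd j) vj≡he)
    ... | inj₂ bwd with next-surjective j
    ... | i , refl = i , injective _ _ (Cycle.es-in Z i) Pe (trans (bwd i) vj≡he)

    cycle-closed : (Z : Cycle G P) → Closed P h (OnCycle Z)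
    cycle-closed Z Pe on ew = proj₂ (inCycle-ends Z (cycle-saturated Z Pe on) ew)

    -- An edge of `Z₁` assigned to a vertex of `Z₂` belongs to `Z₂`, since that vertex is already
    -- saturated by `Z₂`. Hence walking along `Z₁` in the direction of its assignment never leaves
    -- `Z₂`.
    common-vertex : (Z₁ Z₂ : Cycle G P) → ∀ {v} → OnCycle Z₁ v → OnCycle Z₂ v →
                    ∀ e → InCycle G Z₁ e → InCycle G Z₂ e
    common-vertex Z₁ Z₂ (i , refl) on₂ e (j , refl) with cycle-orientation Z₁
    ... | inj₁ fwd = in₂ j (next-induction (λ j → OnCycle Z₂ (vs j))
                       (λ j on → proj₂ (inCycle-ends Z₂ (in₂ j on) (es-join j))) i on₂ j)
      where
      open Cycle Z₁
      in₂ : ∀ j → OnCycle Z₂ (vs j) → InCycle G Z₂ (es j)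
      in₂ j on = cycle-saturated Z₂ (es-in j) (subst (OnCycle Z₂) (sym (fwd j)) on)
    ... | inj₂ bwd = in₂ j (next-coinduction (λ j → OnCycle Z₂ (vs j))
                       (λ j on → proj₁ (inCycle-ends Z₂ (in₂ j on) (es-join j))) i on₂ (next G j))
      where
      open Cycle Z₁
      in₂ : ∀ j → OnCycle Z₂ (vs (next G j)) → InCycle G Z₂ (es j)
      in₂ j on = cycle-saturated Z₂ (es-in j) (subst (OnCycle Z₂) (sym (bwd j)) on)

    -- Transporting `Reach` along the connecting walk leads from `Z₁` into `Z₂`, while closedness of
    -- `Z₁` keeps the path on `Z₁`; so the cycles share a vertex.
    assignment⇒pseudoforest : IsPseudoforest G P
    assignment⇒pseudoforest Z₁ Z₂ (j , l , W) e =
        common-vertex Z₁ Z₂ (proj₁ (proj₂ common)) (proj₂ (proj₂ common)) e ,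
        common-vertex Z₂ Z₁ (proj₂ (proj₂ common)) (proj₁ (proj₂ common)) e
      where
      common : ∃ λ w → OnCycle Z₁ w × OnCycle Z₂ w
      common = reach-closed (cycle-closed Z₁) (Fin.zero , refl)
        (reach-walk (cycle-closed Z₂) (proj₂ (connected-sym (l , W))) (here (j , refl)))

    WithinDist : (Vertex G → Set) → Vertex G → ℕ → Set
    WithinDist X v d = ∃ λ x → X x × ∃ λ l → (l ℕ.≤ d) × Walk G P v x l

    within-mono : ∀ {X v d d′} → d ≤ d′ → WithinDist X v d → WithinDist X v d′
    within-mono d≤d′ (x , x∈X , l , l≤d , W) = x , x∈X , l , ℕP.≤-trans l≤d d≤d′ , W

    -- A vertex outside a closed set but at finite distance from it has an assigned edge, and that
    -- edge leads strictly closer.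
    within⇒closer : ∀ {X} → Closed P h X → ∀ d {v} → WithinDist X v d →
                    X v ⊎ (∃ λ e → ∃ λ w → P e ≡ true × h e ≡ v × Joins G e v w × ∃ λ d′ → (d′ ℕ.< d)
                              × WithinDist X w d′)
    within⇒closer cl d       (x , x∈X , _ , _ , nil) = inj₁ x∈X
    within⇒closer {X} cl (suc d) (x , x∈X , suc l , ℕ.s≤s l≤d , step {w = w} e Pe vw W) with endpoint Pe vw
    ... | inj₁ he≡v = inj₂ (e , w , Pe , he≡v , vw , d , ℕP.≤-refl , (x , x∈X , l , l≤d , W))
    ... | inj₂ refl with within⇒closer {X} cl d (x , x∈X , l , l≤d , W)
    ... | inj₁ w∈X = inj₁ (cl Pe w∈X (joins-sym vw))
    -- The edge assigned to `w` can only be `e`, so the closer neighbour of `w` is `v` itself and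
    -- the smaller bound `d` works for `v`.
    ... | inj₂ (f , u , Pf , hf≡w , wu , d′ , d′<d , near) with refl ← injective f e Pf Pe hf≡w = again back
      where
      back : WithinDist X _ d
      back with joins-unique (joins-sym vw) wu
      ... | inj₁ (_ , refl)    = within-mono (ℕP.<⇒≤ d′<d) near
      ... | inj₂ (refl , refl) = within-mono (ℕP.<⇒≤ d′<d) near
      again : WithinDist X _ d → _
      again near′ with within⇒closer {X} cl d near′
      ... | inj₁ v∈X = inj₁ v∈X
      ... | inj₂ (g , u′ , Pg , hg , vu′ , d″ , d″<d , near″) = inj₂
                (g , u′ , Pg , hg , vu′ , d″ , ℕP.m≤n⇒m≤1+n d″<d , near″)

    -- The bridge from the distance conditions of an orientation to assignments: were `e` assigned
    -- to `v`, it would be the edge leading from `v` closer to `X`, and `u` would be at least as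
    -- near as `v`.
    closer⇒assigned : ∀ {X} → Closed P h X → ∀ {e u v} → P e ≡ true → Joins G e u v →
                      ∀ d → WithinDist X v d → ¬ WithinDist X u d → h e ≡ u
    closer⇒assigned {X} cl {e} {u} {v} Pe uv d near far with endpoint Pe uv
    ... | inj₁ p = p
    ... | inj₂ refl with within⇒closer {X} cl d near
    ... | inj₁ v∈X = ⊥-elim (far (u , cl Pe v∈X (joins-sym uv) , 0 , ℕ.z≤n , nil))
    ... | inj₂ (f , w , Pf , hf≡v , vw , d′ , d′<d , (x , x∈X , l , l≤d′ , W)) with refl ← injective f e Pf Pe hf≡v =
      ⊥-elim (far (x , x∈X , l , ℕP.≤-trans l≤d′ (ℕP.<⇒≤ d′<d) , subst (λ u → Walk G P u x l) w≡u W))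
      where
      w≡u : w ≡ u
      w≡u with joins-unique uv vw
      ... | inj₁ (v≡u , w≡v) = trans w≡v v≡u
      ... | inj₂ (_ , w≡u) = w≡u

∧-trueˡ : ∀ {a b} → a ∧ b ≡ true → a ≡ true
∧-trueˡ {true} _ = refl

∧-trueʳ : ∀ {a b} → a ∧ b ≡ true → b ≡ true
∧-trueʳ {true} p = p

∧-true : ∀ {a b} → a ≡ true → b ≡ true → a ∧ b ≡ true
∧-true refl refl = refl

<ᵇ-true⁻¹ : ∀ {a b} → (a ℕ.<ᵇ b) ≡ true → a ℕ.< b
<ᵇ-true⁻¹ {a} {b} p = ℕP.<ᵇ⇒< a b (subst T (sym p) tt)

<ᵇ-true : ∀ {a b} → a ℕ.< b → (a ℕ.<ᵇ b) ≡ true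
<ᵇ-true {a} {b} a<b with a ℕ.<ᵇ b | ℕP.<⇒<ᵇ a<b
... | true | _ = refl

-- Augmenting paths, and assignments of pseudoforests

module _ (G : Multigraph) where
  open Multigraph G

  add-self : ∀ P e → add G P e e ≡ true
  add-self P e with e FinP.≟ e
  ... | yes _  = refl
  ... | no e≢e = ⊥-elim (e≢e refl)

  add-other : ∀ P {e f} → f ≢ e → add G P e f ≡ P f
  add-other P {e} {f} f≢e with e FinP.≟ f
  ... | yes e≡f = ⊥-elim (f≢e (sym e≡f))
  ... | no _    = refl

  reassign : (Edge G → Vertex G) → Edge G → Vertex G → Edge G → Vertex G
  reassign h e w f with f FinP.≟ e
  ... | yes _ = w
  ... | no _  = h f

  -- As `Q` need only contain the edges of `P` other than `e`, this covers both adding `e` and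
  -- moving an `e` that is already assigned.
  extend : ∀ {P Q h e w x} → Assignment G Q h → (∀ f → P f ≡ true → f ≢ e → Q f ≡ true) →
           (∀ f → Q f ≡ true → f ≢ e → h f ≢ w) → Joins G e w x → Assignment G P (reassign h e w)
  extend {P} {Q} {h} {e} {w} {x} A P⊆Q fresh wx = record { joins = js ; injective = inj }
    where
    open Assignment A
    js : ∀ f → P f ≡ true → ∃ λ y → Joins G f (reassign h e w f) y
    js f Pf with f FinP.≟ e
    ... | yes refl = x , wx
    ... | no f≢e   = joins f (P⊆Q f Pf f≢e)
    inj : ∀ f g → P f ≡ true → P g ≡ true → reassign h e w f ≡ reassign h e w g → f ≡ g
    inj f g Pf Pg eq with f FinP.≟ e | g FinP.≟ e
    ... | yes refl | yes refl = refl
    ... | yes refl | no g≢e   = ⊥-elim (fresh g (P⊆Q g Pg g≢e) g≢e (sym eq))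
    ... | no f≢e   | yes refl = ⊥-elim (fresh f (P⊆Q f Pf f≢e) f≢e eq)
    ... | no f≢e   | no g≢e   = injective f g (P⊆Q f Pf f≢e) (P⊆Q g Pg g≢e) eq

  assignment-mono : ∀ {P Q h} → _⊆_ G P Q → Assignment G Q h → Assignment G P h
  assignment-mono P⊆Q A = record
    { joins = λ e Pe → joins e (P⊆Q e Pe) ; injective = λ e f Pe Pf → injective e f (P⊆Q e Pe) (P⊆Q f Pf) }
    where open Assignment A

  -- The augmenting path of matching theory: from the free end backwards, each edge moves to its far
  -- endpoint, which finally releases `v`.
  augment : ∀ {P h v} → Assignment G P h → Reach G P h (Free G P h) v →
            ∃ λ h′ → Assignment G P h′ × Free G P h′ v
  augment {h = h} A (here free) = h , A , free
  augment {P} {h} {v} A (there {w = w} e Pe he≡v vw r) with augment A r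
  ... | h′ , A′ , free = reassign h′ e w , extend A′ (λ f Pf _ → Pf) (λ f Pf _ → free f Pf) (joins-sym G vw) , free′
    where
    open Assignment A′
    -- The recursive call may have changed the assignment of `e`, but `w` is free under `h′`, so
    -- only `v` remains.
    h′e≡v : h′ e ≡ v
    h′e≡v with endpoint Pe vw
    ... | inj₁ p = p
    ... | inj₂ p = ⊥-elim (free e Pe p)
    free′ : Free G P (reassign h′ e w) v
    free′ f Pf eq with f FinP.≟ e
    ... | yes refl = free e Pe (trans h′e≡v (sym eq))
    ... | no f≢e   = f≢e (injective f e Pf Pe (trans eq (sym h′e≡v)))

  closed-sequence⇒cycle : ∀ {P} d (f : ℕ → Vertex G) (g : ℕ → Edge G) →
    (∀ t → t ℕ.≤ d → P (g t) ≡ true) → (∀ t → t ℕ.≤ d → Joins G (g t) (f t) (f (suc t))) → f (suc d) ≡ f 0 →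
    (∀ s t → s ℕ.< t → t ℕ.≤ d → f s ≢ f t) → (∀ s t → s ℕ.< t → t ℕ.≤ d → g s ≢ g t) → Cycle G P
  closed-sequence⇒cycle d f g g∈P gj fd f-inj g-inj = record
    { len = d ; vs = λ j → f (toℕ j) ; es = λ j → g (toℕ j)
    ; vs-inj = inj f f-inj ; es-inj = inj g g-inj
    ; es-in = λ j → g∈P (toℕ j) (FinP.toℕ≤pred[n] j) ; es-join = es-join }
    where
    inj : ∀ {X : Set} (f : ℕ → X) → (∀ s t → s ℕ.< t → t ℕ.≤ d → f s ≢ f t) →
          ∀ {i j : Fin (suc d)} → f (toℕ i) ≡ f (toℕ j) → i ≡ j
    inj f f-inj {i} {j} eq with ℕP.<-cmp (toℕ i) (toℕ j)
    ... | tri< i<j _ _ = ⊥-elim (f-inj _ _ i<j (FinP.toℕ≤pred[n] j) eq)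
    ... | tri≈ _ i≡j _ = FinP.toℕ-injective i≡j
    ... | tri> _ _ j<i = ⊥-elim (f-inj _ _ j<i (FinP.toℕ≤pred[n] i) (sym eq))
    es-join : ∀ (j : Fin (suc d)) → Joins G (g (toℕ j)) (f (toℕ j)) (f (toℕ (next G j)))
    es-join j with view j
    ... | ‵fromℕ rewrite next-fromℕ G d | FinP.toℕ-fromℕ d = subst (Joins G (g d) (f d)) fd (gj d ℕP.≤-refl)
    ... | ‵inject₁ i rewrite next-inject₁ G i | FinP.toℕ-inject₁ i = gj (toℕ i) (ℕP.<⇒≤ (FinP.toℕ<n i))

  -- Assigned edges can be followed from `a` forever, so by the pigeonhole principle a vertex
  -- recurs. The edges of a shortest return are distinct because each is assigned to the vertex it
  -- leaves.
  endless⇒cycle : ∀ {P h a} → Assignment G P h → ¬ Reach G P h (Free G P h) a →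
                  ¬ (∀ Z → ¬ CycleNear G {P} Z a)
  endless⇒cycle {P} {h} {a} A endless no-cycle =
      repeats (FinP.pigeonhole (ℕP.n<1+n n) (λ (i : Fin (suc n)) → visit (toℕ i)))
    where
    open Assignment A
    Endless : Vertex G → Set
    Endless v = ¬ Reach G P h (Free G P h) v

    exit : ∀ {v} → Endless v → ∃ λ e → ∃ λ w → P e ≡ true × h e ≡ v × Joins G e v w × Endless w
    exit {v} nr with saturated-or-free G P h v
    ... | inj₂ free = ⊥-elim (nr (here free))
    ... | inj₁ (e , Pe , refl) with joins e Pe
    ... | w , vw = e , w , Pe , refl , vw , (λ r → nr (there e Pe refl vw r))

    chain : ℕ → ∃ Endless
    chain zero    = a , endless
    chain (suc t) = let (_ , w , _ , _ , _ , nr) = exit (proj₂ (chain t)) in w , nr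

    visit : ℕ → Vertex G
    visit t = proj₁ (chain t)

    along : ℕ → Edge G
    along t = proj₁ (exit (proj₂ (chain t)))

    along∈P : ∀ t → P (along t) ≡ true
    along∈P t = let (_ , _ , Pe , _) = exit (proj₂ (chain t)) in Pe

    along-assigned : ∀ t → h (along t) ≡ visit t
    along-assigned t = let (_ , _ , _ , he , _) = exit (proj₂ (chain t)) in he

    along-joins : ∀ t → Joins G (along t) (visit t) (visit (suc t))
    along-joins t = let (_ , _ , _ , _ , vw , _) = exit (proj₂ (chain t)) in vw

    visit-connected : ∀ t → Connected G P a (visit t)
    visit-connected zero    = connected-refl G
    visit-connected (suc t) = connected-trans G (visit-connected t) (connected-edge G (along t) (along∈P t)
              (along-joins t))

    -- A return after the fewest possible steps is a cycle.
    no-return : ∀ d i → visit (suc d ℕ.+ i) ≢ visit i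
    no-return = <-rec (λ d → ∀ i → visit (suc d ℕ.+ i) ≢ visit i) λ d ih i eq →
      let distinct : ∀ s t → s ℕ.< t → t ℕ.≤ d → visit (s ℕ.+ i) ≢ visit (t ℕ.+ i)
          distinct s t s<t t≤d p = ih {t ℕ.∸ suc s} (ℕP.<-≤-trans (ℕP.∸-monoʳ-< {t} (ℕ.s≤s ℕ.z≤n) s<t) t≤d) (s ℕ.+ i)
            (trans (cong visit (trans (sym (ℕP.+-suc (t ℕ.∸ suc s) (s ℕ.+ i)))
                     (trans (sym (ℕP.+-assoc (t ℕ.∸ suc s) (suc s) i)) (cong (ℕ._+ i) (ℕP.m∸n+n≡m s<t))))) (sym p))
      in no-cycle
        (closed-sequence⇒cycle d (λ t → visit (t ℕ.+ i)) (λ t → along (t ℕ.+ i)) (λ t _ → along∈P (t ℕ.+ i))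
          (λ t _ → along-joins (t ℕ.+ i)) eq distinct
          (λ s t s<t t≤d p → distinct s t s<t t≤d
            (trans (sym (along-assigned (s ℕ.+ i))) (trans (cong h p) (along-assigned (t ℕ.+ i))))))
        (Fin.zero , visit-connected i)

    repeats : ¬ (∃ λ (i : Fin (suc n)) → ∃ λ j → i Fin.< j × visit (toℕ i) ≡ visit (toℕ j))
    repeats (i , j , i<j , eq) = no-return (toℕ j ℕ.∸ suc (toℕ i)) (toℕ i)
      (trans (cong visit (trans (sym (ℕP.+-suc _ (toℕ i))) (ℕP.m∸n+n≡m i<j))) (sym eq))

  module _ {P Q : EdgeSet G} (Q⊆P : _⊆_ G Q P) {e a b} (Pe : P e ≡ true) (Qe : Q e ≡ false) (ba : Joins G e b a) where

    -- Together with `edgeAt`, traces the walk extended by `e`: after the last vertex `b` comes `a`.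
    vertexAt : ∀ {u l} → Walk G Q u b l → ℕ → Vertex G
    vertexAt {u} W            zero    = u
    vertexAt     nil          (suc t) = a
    vertexAt     (step _ _ _ W) (suc t) = vertexAt W t

    edgeAt : ∀ {u l} → Walk G Q u b l → ℕ → Edge G
    edgeAt nil            t       = e
    edgeAt (step f _ _ W) zero    = f
    edgeAt (step f _ _ W) (suc t) = edgeAt W t

    edgeAt∈Q : ∀ {u l} (W : Walk G Q u b l) t → t ℕ.< l → Q (edgeAt W t) ≡ true
    edgeAt∈Q (step f Qf _ W) zero    _           = Qf
    edgeAt∈Q (step f Qf _ W) (suc t) (ℕ.s≤s t<l) = edgeAt∈Q W t t<l

    edgeAt-last : ∀ {u l} (W : Walk G Q u b l) → edgeAt W l ≡ e
    edgeAt-last nil            = refl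
    edgeAt-last (step _ _ _ W) = edgeAt-last W

    vertexAt-last : ∀ {u l} (W : Walk G Q u b l) → vertexAt W (suc l) ≡ a
    vertexAt-last nil            = refl
    vertexAt-last (step _ _ _ W) = vertexAt-last W

    edgeAt-joins : ∀ {u l} (W : Walk G Q u b l) t → t ℕ.≤ l → Joins G (edgeAt W t) (vertexAt W t) (vertexAt W (suc t))
    edgeAt-joins nil             zero    _           = ba
    edgeAt-joins (step f _ uw W) zero    _           = uw
    edgeAt-joins (step f _ uw W) (suc t) (ℕ.s≤s t≤l) = edgeAt-joins W t t≤l

    walk-take : ∀ {u l} (W : Walk G Q u b l) t → t ℕ.≤ l → Walk G Q u (vertexAt W t) t
    walk-take W                zero    _           = nil
    walk-take (step f Qf uw W) (suc t) (ℕ.s≤s t≤l) = step f Qf uw (walk-take W t t≤l)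

    walk-drop : ∀ {u l} (W : Walk G Q u b l) t → t ℕ.≤ l → Walk G Q (vertexAt W t) b (l ℕ.∸ t)
    walk-drop W                zero    _           = W
    walk-drop (step f Qf uw W) (suc t) (ℕ.s≤s t≤l) = walk-drop W t t≤l

    -- A shortest walk closes up with e to a cycle.
    connected-ends⇒cycle : Connected G Q a b → ¬ (∀ Z → ¬ InCycle G {P} Z e)
    connected-ends⇒cycle (l , W) no-cycle = <-rec (λ l → ¬ Walk G Q a b l) go l W
      where
      go : ∀ l → (∀ {l′} → l′ ℕ.< l → ¬ Walk G Q a b l′) → ¬ Walk G Q a b l
      go l ih W = no-cycle
          (closed-sequence⇒cycle l (vertexAt W) (edgeAt W) in-P (edgeAt-joins W) (vertexAt-last W) distinct distinctᵉ)
          (fromℕ l , trans (cong (edgeAt W) (FinP.toℕ-fromℕ l)) (edgeAt-last W))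
        where
        in-P : ∀ t → t ℕ.≤ l → P (edgeAt W t) ≡ true
        in-P t t≤l with ℕP.m≤n⇒m<n∨m≡n t≤l
        ... | inj₁ t<l  = Q⊆P _ (edgeAt∈Q W t t<l)
        ... | inj₂ refl = trans (cong P (edgeAt-last W)) Pe
        distinct : ∀ s t → s ℕ.< t → t ℕ.≤ l → vertexAt W s ≢ vertexAt W t
        distinct s t s<t t≤l eq = ih shorter
            (walk-++ G (subst (λ v → Walk G Q a v s) eq (walk-take W s (ℕP.<⇒≤ (ℕP.<-≤-trans s<t t≤l))))
                      (walk-drop W t t≤l))
          where
          shorter : s ℕ.+ (l ℕ.∸ t) ℕ.< l
          shorter = subst (s ℕ.+ (l ℕ.∸ t) ℕ.<_) (ℕP.m+[n∸m]≡n t≤l) (ℕP.+-monoˡ-< (l ℕ.∸ t) s<t)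
        distinctᵉ : ∀ s t → s ℕ.< t → t ℕ.≤ l → edgeAt W s ≢ edgeAt W t
        distinctᵉ s t s<t t≤l eq with ℕP.m≤n⇒m<n∨m≡n t≤l
        ... | inj₂ refl = true≢false (edgeAt∈Q W s s<t) (trans (cong Q (trans eq (edgeAt-last W))) Qe)
        ... | inj₁ t<l with joins-unique G (edgeAt-joins W s (ℕP.<⇒≤ (ℕP.<-≤-trans s<t t≤l)))
                              (subst (λ f → Joins G f _ _) (sym eq) (edgeAt-joins W t t≤l))
        ... | inj₁ (p , _) = distinct s t s<t t≤l (sym p)
        -- The two positions traverse the edge in opposite directions. Position `t` may equal
        -- `s + 1`, so the contradiction comes from positions `s` and `t + 1`.
        ... | inj₂ (_ , p) = distinct s (suc t) (ℕP.m≤n⇒m≤1+n s<t) t<l (sym p)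

  -- Edges are inserted one at a time by augmentation. If neither end of `e` reaches a free vertex,
  -- there are earlier cycles near both ends. In `P` these lie in one component, so they have the
  -- same edges and the ends of `e` were already connected; then `e` closes a further cycle there,
  -- which must also consist of earlier edges.
  pseudoforest⇒assignment : ∀ {P} → IsPseudoforest G P → ¬ ¬ (∃ λ h → Assignment G P h)
  pseudoforest⇒assignment {P} pf none =
      build m ℕP.≤-refl (λ (h , A) → none (h , assignment-mono (λ e Pe → ∧-true Pe (<ᵇ-true (FinP.toℕ<n e))) A))
    where
    below : ℕ → EdgeSet G
    below t e = P e ∧ (toℕ e ℕ.<ᵇ t)

    below⊆P : ∀ t → _⊆_ G (below t) P
    below⊆P t e = ∧-trueˡ

    build : ∀ t → t ℕ.≤ m → ¬ ¬ (∃ λ h → Assignment G (below t) h)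
    build zero 0≤m k = k ((λ e → proj₁ (ends e)) , record
      { joins = λ e Qe → ⊥-elim (true≢false (∧-trueʳ {P e} Qe) refl)
      ; injective = λ e f Qe Qf _ → ⊥-elim (true≢false (∧-trueʳ {P e} Qe) refl) })
    build (suc t) t<m k = build t (ℕP.<⇒≤ t<m) grow
      where
      e = Fin.fromℕ< t<m
      toℕ-e = FinP.toℕ-fromℕ< t<m
      others : ∀ f → below (suc t) f ≡ true → f ≢ e → below t f ≡ true
      others f Qf f≢e = ∧-true (∧-trueˡ Qf) (<ᵇ-true (ℕP.≤∧≢⇒< (ℕP.≤-pred (<ᵇ-true⁻¹ (∧-trueʳ {P f} Qf)))
        (λ p → f≢e (FinP.toℕ-injective (trans p (sym toℕ-e))))))
      e∉ : below t e ≡ false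
      e∉ = ≢true⇒false (λ Qe → ℕP.<-irrefl toℕ-e (<ᵇ-true⁻¹ (∧-trueʳ {P e} Qe)))
      grow : ¬ (∃ λ h → Assignment G (below t) h)
      grow (h , A) with P e in Pe
      ... | false = k (h , assignment-mono (λ f Qf → others f Qf
                      (λ { refl → true≢false (∧-trueˡ Qf) Pe })) A)
      ... | true = endless⇒cycle A (stuck ab) λ Z₁ near₁ → endless⇒cycle A (stuck (joins-sym G ab)) (clash Z₁ near₁)
        where
        a = proj₁ (ends e)
        b = proj₂ (ends e)
        ab = joins-ends G e
        stuck : ∀ {x y} → Joins G e x y → ¬ Reach G (below t) h (Free G (below t) h) x
        stuck {x} xy r with h′ , A′ , free ← augment A r =
          k (reassign h′ e x , extend A′ others (λ f Qf _ → free f Qf) xy)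
        clash : ∀ Z₁ → CycleNear G {below t} Z₁ a → ∀ Z₂ → ¬ CycleNear G {below t} Z₂ b
        clash Z₁ (i , near₁) Z₂ (j , near₂) =
            connected-ends⇒cycle (below⊆P t) Pe e∉ (joins-sym G ab) a~b λ Z₃ e∈Z₃ →
              same-component Z₃ e∈Z₃
          where
          lift : ∀ {u v} → Connected G (below t) u v → Connected G P u v
          lift = connected-mono G (below⊆P t)
          Z₁′ = cycle-mono G (below⊆P t) Z₁
          Z₂′ = cycle-mono G (below⊆P t) Z₂
          start~a : Connected G (below t) (Cycle.vs Z₁ Fin.zero) a
          start~a = connected-trans G (cycle-connected G Z₁ Fin.zero i) (connected-sym G near₁)
          Z₁-near-Z₂ : CycleNear G Z₂′ (Cycle.vs Z₁ Fin.zero)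
          Z₁-near-Z₂ = j , connected-trans G (lift start~a) (connected-trans G (connected-edge G e Pe ab) (lift near₂))
          a~b : Connected G (below t) a b
          a~b with inCycle-ends G Z₂ (proj₁ (pf Z₁′ Z₂′ Z₁-near-Z₂ _) (Fin.zero , refl)) (Cycle.es-join Z₁ Fin.zero)
          ... | (j′ , eq) , _ = connected-trans G (connected-sym G start~a)
                (subst (λ v → Connected G (below t) v b) eq
                  (connected-trans G (cycle-connected G Z₂ j′ j) (connected-sym G near₂)))
          same-component : ∀ Z₃ → ¬ InCycle G {P} Z₃ e
          same-component Z₃ e∈Z₃ with proj₁ (inCycle-ends G Z₃ e∈Z₃ ab)
          ... | (i₃ , eq) with proj₂ (pf Z₁′ Z₃ (i₃ , subst (Connected G P _) (sym eq) (lift start~a)) e) e∈Z₃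
          ... | i′ , eq′ = true≢false (trans (cong (below t) (sym eq′)) (Cycle.es-in Z₁ i′)) e∉

  tail-head : ∀ o e → Joins G e (Tail G o e) (Head G o e)
  tail-head o e with o e
  ... | true  = inj₁ refl
  ... | false = inj₂ refl

  -- In each case two edges with tail `u` are assigned to the same vertex, or are compared on the
  -- cycle itself. An edge on the cycle and one off it cannot share a tail, since the tail of the
  -- latter has positive distance to the cycle.
  orientation-out-degree : ∀ {P o} → IsPseudoforest G P → IsOrientationOf G P o →
    ∀ {u e f} → P e ≡ true → P f ≡ true → Tail G o e ≡ u → Tail G o f ≡ u → e ≡ f
  orientation-out-degree {P} {o} pf (cyclic , to-cycle , to-root) {u} {e} {f} Pe Pf te tf =
      decidable-stable (e FinP.≟ f) λ e≢f → pseudoforest⇒assignment pf λ (h , A) →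
        acyclic e≢f A (λ Z near → e≢f (unicyclic A Z near))
    where
    module _ {h} (A : Assignment G P h) where
      open Assignment A

      off-cycle : ∀ Z → CycleNear G Z u → ∀ e → P e ≡ true → Tail G o e ≡ u → ¬ InCycle G Z e →
                  h e ≡ u × ¬ OnCycle G Z u
      off-cycle Z near e Pe refl e∉Z with to-cycle Z e Pe e∉Z near
      ... | d , (j , l , l≤d , W) , far =
        closer⇒assigned G A (cycle-closed G A Z) Pe (tail-head o e) d (_ , (j , refl) , l , l≤d , W)
          (λ { (_ , (j , refl) , l , l≤d , W) → far (j , l , l≤d , W) }) ,
        (λ { (j , eq) → far (j , 0 , ℕ.z≤n , subst (λ v → Walk G P (Tail G o e) v 0) (sym eq) nil) })

      on-cycle : ∀ Z e → Tail G o e ≡ u → InCycle G Z e → OnCycle G Z u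
      on-cycle Z e refl e∈Z = proj₁ (inCycle-ends G Z e∈Z (tail-head o e))

      unicyclic : ∀ Z → CycleNear G Z u → e ≡ f
      unicyclic Z near with inCycle? G Z e | inCycle? G Z f
      ... | no e∉Z  | no f∉Z  = injective e f Pe Pf (trans (proj₁ (off-cycle Z near e Pe te e∉Z))
                                  (sym (proj₁ (off-cycle Z near f Pf tf f∉Z))))
      ... | no e∉Z  | yes f∈Z = ⊥-elim (proj₂ (off-cycle Z near e Pe te e∉Z) (on-cycle Z f tf f∈Z))
      ... | yes e∈Z | no f∉Z  = ⊥-elim (proj₂ (off-cycle Z near f Pf tf f∉Z) (on-cycle Z e te e∈Z))
      ... | yes (i , refl) | yes (j , refl) with cyclic Z
      ... | inj₁ fwd = cong (Cycle.es Z) (Cycle.vs-inj Z (trans (sym (proj₁ (fwd i))) (trans (trans te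
                (sym tf)) (proj₁ (fwd j)))))
      ... | inj₂ bwd = cong (Cycle.es Z) (next-injective G i j (Cycle.vs-inj Z
                         (trans (sym (proj₁ (bwd i))) (trans (trans te (sym tf)) (proj₁ (bwd j))))))

    acyclic : e ≢ f → ∀ {h} → Assignment G P h → ¬ (∀ (Z : Cycle G P) → ¬ CycleNear G Z u)
    acyclic e≢f A none with to-root u none
    -- The root must reach a free vertex, as otherwise its component would contain a cycle.
    -- Augmentation then frees the root and makes it a closed target for `closer⇒assigned`.
    ... | r , u~r , towards = endless⇒cycle A
          (λ reach → let (h , A′ , free) = augment A reach in
            e≢f (Assignment.injective A′ e f Pe Pf
              (trans (assigned A′ free e Pe te) (sym (assigned A′ free f Pf tf)))))
          (λ Z (j , r~Z) → none Z (j , connected-trans G u~r r~Z))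
      where
      assigned : ∀ {h} → Assignment G P h → Free G P h r → ∀ e → P e ≡ true → Tail G o e ≡ u → h e ≡ u
      assigned A′ free e Pe refl with towards e Pe (connected-refl G)
      ... | d , (l , l≤d , W) , far =
        closer⇒assigned G A′ {_≡ r} (λ {e} Pe he≡r _ → ⊥-elim (free e Pe he≡r)) Pe (tail-head o e) d
          (r , refl , l , l≤d , W) (λ { (_ , refl , l , l≤d , W) → far (l , l≤d , W) })

-- Counting and the density of level sets

sumℕ-cong : ∀ {n} {f g : Fin n → ℕ} → (∀ i → f i ≡ g i) → sumℕ f ≡ sumℕ g
sumℕ-cong {zero}  eq = refl
sumℕ-cong {suc n} eq = cong₂ ℕ._+_ (eq Fin.zero) (sumℕ-cong (λ i → eq (Fin.suc i)))

sumℕ-mono : ∀ {n} {f g : Fin n → ℕ} → (∀ i → f i ℕ.≤ g i) → sumℕ f ℕ.≤ sumℕ g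
sumℕ-mono {zero}  le = ℕ.z≤n
sumℕ-mono {suc n} le = ℕP.+-mono-≤ (le Fin.zero) (sumℕ-mono (λ i → le (Fin.suc i)))

sumℕ-+ : ∀ {n} (f g : Fin n → ℕ) → sumℕ (λ i → f i ℕ.+ g i) ≡ sumℕ f ℕ.+ sumℕ g
sumℕ-+ {zero}  f g = refl
sumℕ-+ {suc n} f g = trans (cong (f Fin.zero ℕ.+ g Fin.zero ℕ.+_) (sumℕ-+ (λ i → f (Fin.suc i)) (λ i → g (Fin.suc i))))
    (solve 4 (λ a b c d → a :+ b :+ (c :+ d) := a :+ c :+ (b :+ d)) refl (f Fin.zero) (g Fin.zero) _ _)
  where open ℕ-Solver

weighted : ∀ {n} → (Fin n → ℕ) → (Fin n → Bool) → ℕ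
weighted w P = sumℕ (λ e → if P e then w e else 0)

weighted-extract : ∀ {n} (w : Fin n → ℕ) {P Q : Fin n → Bool} f → P f ≡ true → Q f ≡ false →
                   (∀ e → e ≢ f → P e ≡ Q e) → weighted w P ≡ w f ℕ.+ weighted w Q
weighted-extract w {P} {Q} Fin.zero Pf Qf same rewrite Pf | Qf =
  cong (w Fin.zero ℕ.+_) (sumℕ-cong (λ e → cong (if_then w (Fin.suc e) else 0) (same (Fin.suc e) (λ ()))))
weighted-extract w {P} {Q} (Fin.suc f) Pf Qf same =
  trans (cong₂ ℕ._+_ (cong (if_then w Fin.zero else 0) (same Fin.zero (λ ())))
          (weighted-extract (λ e → w (Fin.suc e)) f Pf Qf (λ e e≢f → same (Fin.suc e) (λ p → e≢f
                    (FinP.suc-injective p)))))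
    (solve 3 (λ a b c → a :+ (b :+ c) := b :+ (a :+ c)) refl (if Q Fin.zero then w Fin.zero else 0) (w (Fin.suc f))
      (weighted (λ e → w (Fin.suc e)) (λ e → Q (Fin.suc e))))
  where open ℕ-Solver

_∖_ : ∀ {n} → (Fin n → Bool) → Fin n → Fin n → Bool
(P ∖ f) e = P e ∧ not (isYes (e FinP.≟ f))

∖-self : ∀ {n} (P : Fin n → Bool) f → (P ∖ f) f ≡ false
∖-self P f with f FinP.≟ f | P f
... | yes _  | true  = refl
... | yes _  | false = refl
... | no f≢f | _     = ⊥-elim (f≢f refl)

∖-other : ∀ {n} (P : Fin n → Bool) {e f} → e ≢ f → (P ∖ f) e ≡ P e
∖-other P {e} {f} e≢f with e FinP.≟ f | P e
... | yes e≡f | _     = ⊥-elim (e≢f e≡f)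
... | no _    | true  = refl
... | no _    | false = refl

weighted-∖ : ∀ {n} (w : Fin n → ℕ) {P : Fin n → Bool} f → P f ≡ true → weighted w P ≡ w f ℕ.+ weighted w (P ∖ f)
weighted-∖ w {P} f Pf = weighted-extract w f Pf (∖-self P f) (λ e e≢f → sym (∖-other P e≢f))

-- A relation instead of a function, so that the partner of `i` may depend on the proof that `i`
-- belongs to `A`.
count-injection : ∀ {a b} (A : Fin a → Bool) (B : Fin b → Bool) (R : Fin a → Fin b → Set) →
  (∀ i → A i ≡ true → ∃ λ j → B j ≡ true × R i j) → (∀ i i′ j → R i j → R i′ j → i ≡ i′) → count A ℕ.≤ count B
count-injection {zero}  A B R total inj = ℕ.z≤n
count-injection {suc a} A B R total inj with A Fin.zero in A0
... | false = count-injection (λ i → A (Fin.suc i)) B (λ i → R (Fin.suc i)) (λ i → total (Fin.suc i))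
                (λ i i′ j r r′ → FinP.suc-injective (inj _ _ j r r′))
... | true with total Fin.zero A0
... | j , Bj , r = subst (suc (count (λ i → A (Fin.suc i))) ℕ.≤_) (sym (weighted-∖ (λ _ → 1) j Bj))
        (ℕ.s≤s (count-injection (λ i → A (Fin.suc i)) (B ∖ j) (λ i → R (Fin.suc i)) total′
          (λ i i′ j r r′ → FinP.suc-injective (inj _ _ j r r′))))
  where
  total′ : ∀ i → A (Fin.suc i) ≡ true → ∃ λ j′ → (B ∖ j) j′ ≡ true × R (Fin.suc i) j′
  total′ i Ai with total (Fin.suc i) Ai
  ... | j′ , Bj′ , r′ = j′ , trans (∖-other B (λ { refl → FinP.0≢1+n (inj _ _ j r r′) })) Bj′ , r′

count-mono : ∀ {n} {A B : Fin n → Bool} → (∀ i → A i ≡ true → B i ≡ true) → count A ℕ.≤ count B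
count-mono {A = A} {B} A⊆B = sumℕ-mono le
  where
  le : ∀ i → indicator (A i) ℕ.≤ indicator (B i)
  le i with A i in Ai
  ... | false = ℕ.z≤n
  ... | true rewrite A⊆B i Ai = ℕP.≤-refl

count-split : ∀ {n} (A X : Fin n → Bool) → count A ≡ count (λ i → A i ∧ X i) ℕ.+ count (λ i → A i ∧ not (X i))
count-split A X = trans (sumℕ-cong (λ i → split (A i) (X i))) (sumℕ-+ (λ i → indicator (A i ∧ X i)) (λ i
          → indicator (A i ∧ not (X i))))
  where
  split : ∀ a x → indicator a ≡ indicator (a ∧ x) ℕ.+ indicator (a ∧ not x)
  split true  true  = refl
  split true  false = refl
  split false _     = refl

count-positive : ∀ {n} {A : Fin n → Bool} i → A i ≡ true → 0 ℕ.< count A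
count-positive {A = A} i Ai = subst (0 ℕ.<_) (sym (weighted-∖ (λ _ → 1) i Ai)) (ℕ.s≤s ℕ.z≤n)

count-empty : ∀ {n} {A : Fin n → Bool} → (∀ i → A i ≡ false) → count A ≡ 0
count-empty {zero}  none = refl
count-empty {suc n} none rewrite none Fin.zero = count-empty (λ i → none (Fin.suc i))

-- Allows the undecided property `Reach` to be turned into a Boolean vertex set.
¬¬-decide-all : ∀ {n} (D : Fin n → Set) → ¬ ¬ (∀ i → Dec (D i))
¬¬-decide-all {zero}  D k = k (λ ())
¬¬-decide-all {suc n} D k = ¬¬-decide-all (λ i → D (Fin.suc i)) λ ds → ¬¬-excluded-middle λ d →
  k (λ { Fin.zero → d ; (Fin.suc i) → ds i })

-- Saturated vertex sets and exchange in minimum-weight pseudoforests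

module _ (G : Multigraph) where
  open Multigraph G

  inside : VertexSet G → EdgeSet G
  inside U e = U (proj₁ (ends e)) ∧ U (proj₂ (ends e))

  inside-intro : ∀ {U e x y} → Joins G e x y → U x ≡ true → U y ≡ true → inside U e ≡ true
  inside-intro (inj₁ refl) Ux Uy = ∧-true Ux Uy
  inside-intro (inj₂ refl) Ux Uy = ∧-true Uy Ux

  inside-elim : ∀ {U e x y} → Joins G e x y → inside U e ≡ true → U x ≡ true
  inside-elim (inj₁ refl) p = ∧-trueˡ p
  inside-elim {U} {e} (inj₂ refl) p = ∧-trueʳ {U (proj₁ (ends e))} p

  -- U is the set of vertices from which the assigned edges never lead to a free vertex.
  saturated-set : ∀ {H h} → Assignment G H h → (F : EdgeSet G) →
    (∀ {e x y} → F e ≡ true → H e ≡ false → Joins G e x y → ¬ Reach G H h (Free G H h) x) →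
    ¬ ¬ (∃ λ U → (∀ e → F e ≡ true → H e ≡ false → inside U e ≡ true) ×
                 count U ℕ.≤ count (λ e → H e ∧ inside U e))
  saturated-set {H} {h} A F stuck k = ¬¬-decide-all (Reach G H h (Free G H h)) λ reach? →
    let U : VertexSet G
        U v = not (isYes (reach? v))
        U-intro : ∀ {v} → ¬ Reach G H h (Free G H h) v → U v ≡ true
        U-intro {v} nr = intro (reach? v) nr
        U-elim : ∀ {v} → U v ≡ true → ¬ Reach G H h (Free G H h) v
        U-elim {v} Uv = elim (reach? v) Uv
    in k (U , (λ e Fe He → ∧-true (U-intro (stuck Fe He (joins-ends G e))) (U-intro (stuck Fe He (joins-sym G
              (joins-ends G e)))))
           , count-injection U (λ e → H e ∧ inside U e) (λ v e → h e ≡ v)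
               (λ v Uv → successor U U-intro (U-elim Uv)) (λ { _ _ _ refl refl → refl }))
    where
    open Assignment A
    intro : ∀ {D : Set} (d : Dec D) → ¬ D → not (isYes d) ≡ true
    intro (yes p) np = ⊥-elim (np p)
    intro (no _)  _  = refl
    elim : ∀ {D : Set} (d : Dec D) → not (isYes d) ≡ true → ¬ D
    elim (no np) _ = np
    successor : ∀ U → (∀ {v} → ¬ Reach G H h (Free G H h) v → U v ≡ true) →
                ∀ {v} → ¬ Reach G H h (Free G H h) v → ∃ λ e → (H e ∧ inside U e) ≡ true × h e ≡ v
    successor U U-intro {v} nr with saturated-or-free G H h v
    ... | inj₂ free = ⊥-elim (nr (here free))
    ... | inj₁ (e , He , refl) with joins e He
    ... | w , vw = e , ∧-true He (inside-intro {U} vw (U-intro nr) (U-intro (λ r → nr (there e He refl vw r)))) , refl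

  maximal⇒stuck : ∀ {P h} → IsMaximalPseudoforest G P → Assignment G P h →
                  ∀ {e x y} → P e ≡ false → Joins G e x y → ¬ Reach G P h (Free G P h) x
  maximal⇒stuck {P} (_ , maximal) A {e} {x} Pe xy r with augment G A r
  ... | h′ , A′ , free = maximal e Pe (assignment⇒pseudoforest G
    (extend G A′ (λ f Pf f≢e → trans (sym (add-other G P f≢e)) Pf) (λ f Pf _ → free f Pf) xy))

  -- Equal cardinality of bases. Inside the saturated set `U`, `Q` has at most `|U|` edges and `P`
  -- at least `|U|`; every edge not inside `U` is in `P`.
  maximal⇒largest : ∀ {P Q h h′} → IsMaximalPseudoforest G P → Assignment G P h → Assignment G Q h′ →
                    count Q ℕ.≤ count P
  maximal⇒largest {P} {Q} {h} {h′} maximal A B = decidable-stable (count Q ℕP.≤? count P) λ larger →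
    saturated-set A (λ _ → true) (λ _ → maximal⇒stuck maximal A) λ (U , covers , |U|≤) → larger (begin
      count Q
        ≡⟨ count-split Q (inside U) ⟩
      count (λ e → Q e ∧ inside U e) ℕ.+ count (λ e → Q e ∧ not (inside U e))
        ≤⟨ ℕP.+-mono-≤ (ℕP.≤-trans (within U) |U|≤) (count-mono (outside U covers)) ⟩
      count (λ e → P e ∧ inside U e) ℕ.+ count (λ e → P e ∧ not (inside U e))
        ≡⟨ count-split P (inside U) ⟨
      count P ∎)
    where
    open ℕP.≤-Reasoning
    open Assignment B
    within : ∀ U → count (λ e → Q e ∧ inside U e) ℕ.≤ count U
    within U = count-injection _ U (λ e v → Q e ≡ true × h′ e ≡ v)
      (λ e p → h′ e , inside-elim {U} (proj₂ (joins e (∧-trueˡ p))) (∧-trueʳ {Q e} p) , ∧-trueˡ p , refl)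
      (λ { e f _ (Qe , refl) (Qf , eq) → injective e f Qe Qf (sym eq) })
    outside : ∀ U → (∀ e → true ≡ true → P e ≡ false → inside U e ≡ true) →
              ∀ e → (Q e ∧ not (inside U e)) ≡ true → (P e ∧ not (inside U e)) ≡ true
    outside U covers e p with P e in Pe
    ... | true  = ∧-trueʳ {Q e} p
    ... | false with () ← trans (sym (∧-trueʳ {Q e} p)) (cong not (covers e refl Pe))

  -- The end of the path is either free for `P` or occupied by an edge `f` outside `F`. The path
  -- uses edges of `F` only, so it survives the removal of `f`, which frees its end.
  reach-restrict : ∀ {P h} → Assignment G P h → (F : EdgeSet G) → ∀ {v} →
    Reach G (λ e → P e ∧ F e) h (Free G (λ e → P e ∧ F e) h) v →
    Reach G P h (Free G P h) v ⊎
    (∃ λ f → P f ≡ true × F f ≡ false × Reach G (P ∖ f) h (Free G (P ∖ f) h) v)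
  reach-restrict {P} {h} A F (here {v} free) with saturated-or-free G P h v
  ... | inj₂ free′ = inj₁ (here free′)
  ... | inj₁ (f , Pf , refl) = inj₂ (f , Pf , ≢true⇒false (λ Ff → free f (∧-true Pf Ff) refl) ,
      here (λ g g∈ hg≡hf → true≢false (trans (cong (P ∖ f) (sym (Assignment.injective A g f
                (∧-trueˡ g∈) Pf hg≡hf))) g∈) (∖-self P f)))
  reach-restrict {P} A F (there e e∈ he vw r) with reach-restrict A F r
  ... | inj₁ r′ = inj₁ (there e (∧-trueˡ e∈) he vw r′)
  ... | inj₂ (f , Pf , Ff , r′) = inj₂ (f , Pf , Ff ,
      there e (trans (∖-other P (λ { refl → true≢false (∧-trueʳ {P e} e∈) Ff })) (∧-trueˡ e∈)) he vw r′)

  module _ {w P} (minimal : IsMinWeightMaxPseudoforest G w P) where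

    -- Otherwise augmenting after the removal of `f` would make room for `e`, and the exchange would
    -- yield a lighter maximal pseudoforest.
    exchange-heavier : ∀ {h} → Assignment G P h → ∀ {e f x y} → P e ≡ false → P f ≡ true → w e ℕ.< w f →
                       Joins G e x y → ¬ Reach G (P ∖ f) h (Free G (P ∖ f) h) x
    exchange-heavier {h} A {e} {f} {x} Pe Pf we<wf xy r
      with augment G (assignment-mono G (λ g → ∧-trueˡ) A) r
    ... | h′ , A′ , free = ℕP.<⇒≱ lighter (proj₂ minimal P′ (assignment⇒pseudoforest G A″ , maximal′))
      where
      R  = P ∖ f
      P′ = add G R e
      A″ : Assignment G P′ (reassign G h′ e x)
      A″ = extend G A′ (λ g Pg g≢e → trans (sym (add-other G R g≢e)) Pg) (λ g Rg _ → free g Rg) xy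
      R∌e : R e ≡ false
      R∌e = ≢true⇒false (λ Re → true≢false (∧-trueˡ Re) Pe)
      -- Stated for every weight: the given one shows that `P′` is lighter, the constant weight 1
      -- that it is as large as `P`.
      exchange-weight : ∀ w → weighted w P ℕ.+ w e ≡ weighted w P′ ℕ.+ w f
      exchange-weight w rewrite weighted-∖ w {P} f Pf
        | weighted-extract w {P′} {R} e (add-self G R e) R∌e (λ g g≢e → add-other G R g≢e) =
        solve 3 (λ a b c → a :+ c :+ b := b :+ c :+ a) refl (w f) (w e) (weighted w R)
        where open ℕ-Solver
      lighter : weighted w P′ ℕ.< weighted w P
      lighter = ℕP.+-cancelʳ-< (w e) (weighted w P′) (weighted w P)
        (subst (weighted w P′ ℕ.+ w e ℕ.<_) (sym (exchange-weight w)) (ℕP.+-monoʳ-< (weighted w P′) we<wf))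
      -- A pseudoforest containing one more edge than `P′` would be larger than `P`.
      maximal′ : ∀ g → P′ g ≡ false → ¬ IsPseudoforest G (add G P′ g)
      maximal′ g P′g pf = pseudoforest⇒assignment G pf λ (h″ , B) →
        ℕP.<⇒≱ (subst (ℕ._< count (add G P′ g)) (sym (ℕP.+-cancelʳ-≡ 1 (count P) (count P′) (exchange-weight
                  (λ _ → 1))))
                 (ℕP.≤-reflexive (sym (weighted-extract (λ _ → 1) {add G P′ g} {P′} g (add-self G P′ g) P′g
                   (λ e e≢g → add-other G P′ e≢g)))))
          (maximal⇒largest (proj₁ minimal) A B)

    -- Edges not in `P` are no heavier than `t` here, while every edge of `P` outside `F` is
    -- heavier, so `reach-restrict` leaves only a violation of maximality or a forbidden exchange.
    -- The factor `ρ ≥ 1` absorbs the edges not inside `U`.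
    level-density : ∀ {ρ} → 1ℚ ≤ℚ ρ →
      (∀ (S : VertexSet G) → 0 ℕ.< count S → ℕtoℚ (inducedCount G S) ≤ℚ ρ * ℕtoℚ (count S)) →
      ∀ t → ℕtoℚ (count (λ e → w e ℕ.≤ᵇ t)) ≤ℚ ρ * ℕtoℚ (count (λ e → P e ∧ (w e ℕ.≤ᵇ t)))
    level-density {ρ} 1≤ρ density t = decidable-stable (ℕtoℚ (count F) ≤? (ρ * ℕtoℚ (count H))) λ sparse →
      pseudoforest⇒assignment G (proj₁ (proj₁ minimal)) λ (h , A) →
      saturated-set (assignment-mono G (λ e → ∧-trueˡ) A) F (stuck A) λ (U , covers , |U|≤) →
      sparse (begin
        ℕtoℚ (count F)
          ≤⟨ ℕtoℚ-mono-≤ {count F} (split U covers) ⟩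
        ℕtoℚ (count (inside U) ℕ.+ outside U)
          ≡⟨ ℕtoℚ-+ (count (inside U)) (outside U) ⟩
        ℕtoℚ (count (inside U)) + ℕtoℚ (outside U)
          ≤⟨ +-mono-≤ (density′ U) (weaken (outside U)) ⟩
        ρ * ℕtoℚ (count U) + ρ * ℕtoℚ (outside U)
          ≤⟨ +-monoˡ-≤ (ρ * ℕtoℚ (outside U)) (*-monoˡ-≤-nonNeg ρ {{nonNegative 0≤ρ}}
               (ℕtoℚ-mono-≤ {count U} |U|≤)) ⟩
        ρ * ℕtoℚ (count (λ e → H e ∧ inside U e)) + ρ * ℕtoℚ (outside U)
          ≡⟨ *-distribˡ-+ ρ (ℕtoℚ (count (λ e → H e ∧ inside U e))) (ℕtoℚ (outside U)) ⟨
        ρ * (ℕtoℚ (count (λ e → H e ∧ inside U e)) + ℕtoℚ (outside U))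
          ≡⟨ cong (ρ *_) (ℕtoℚ-+ (count (λ e → H e ∧ inside U e)) (outside U)) ⟨
        ρ * ℕtoℚ (count (λ e → H e ∧ inside U e) ℕ.+ outside U)
          ≡⟨ cong (λ c → ρ * ℕtoℚ c) (count-split H (inside U)) ⟨
        ρ * ℕtoℚ (count H) ∎)
      where
      open ≤-Reasoning
      F H : EdgeSet G
      F e = w e ℕ.≤ᵇ t
      H e = P e ∧ F e
      outside : VertexSet G → ℕ
      outside U = count (λ e → H e ∧ not (inside U e))
      0≤ρ : 0ℚ ≤ℚ ρ
      0≤ρ = ≤-trans 0≤1 1≤ρ
      weaken : ∀ a → ℕtoℚ a ≤ℚ ρ * ℕtoℚ a
      weaken a = subst (_≤ℚ ρ * ℕtoℚ a) (*-identityˡ (ℕtoℚ a)) (*-monoʳ-≤-nonNeg (ℕtoℚ a) {{nonNegative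
                (0≤ℕtoℚ a)}} 1≤ρ)
      H∌⇒P∌ : ∀ {e} → F e ≡ true → H e ≡ false → P e ≡ false
      H∌⇒P∌ Fe He = ≢true⇒false (λ Pe → true≢false (∧-true Pe Fe) He)
      ≤ᵇ-true⁻¹ : ∀ {a} → (a ℕ.≤ᵇ t) ≡ true → a ℕ.≤ t
      ≤ᵇ-true⁻¹ {a} p = ℕP.≤ᵇ⇒≤ a t (subst T (sym p) tt)
      stuck : ∀ {h} → Assignment G P h → ∀ {e x y} → F e ≡ true → H e ≡ false → Joins G e x y → ¬ Reach G H h
                (Free G H h) x
      stuck A Fe He xy r with reach-restrict A F r
      ... | inj₁ r′ = maximal⇒stuck (proj₁ minimal) A (H∌⇒P∌ Fe He) xy r′
      ... | inj₂ (f , Pf , Ff , r′) = exchange-heavier A (H∌⇒P∌ Fe He) Pf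
              (ℕP.≤-<-trans (≤ᵇ-true⁻¹ Fe) (ℕP.≰⇒> (λ wf≤t → true≢false (≤ᵇ-true wf≤t) Ff))) xy r′
      split : ∀ U → (∀ e → F e ≡ true → H e ≡ false → inside U e ≡ true) → count F ℕ.≤ count (inside U) ℕ.+ outside U
      split U covers = subst (ℕ._≤ count (inside U) ℕ.+ outside U) (sym (count-split F (inside U)))
          (ℕP.+-mono-≤ (count-mono (λ e → ∧-trueʳ {F e})) (count-mono rest))
        where
        rest : ∀ e → (F e ∧ not (inside U e)) ≡ true → (H e ∧ not (inside U e)) ≡ true
        rest e p with P e in Pe
        ... | true  = p
        ... | false with () ← trans (sym (∧-trueʳ {F e} p)) (cong not (covers e (∧-trueˡ p) (cong (_∧ F e) Pe)))
      density′ : ∀ U → ℕtoℚ (count (inside U)) ≤ℚ ρ * ℕtoℚ (count U)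
      density′ U with 0 ℕP.<? count U
      ... | yes 0<|U| = density U 0<|U|
      -- The density hypothesis is silent about the empty set, which contains no edge.
      ... | no |U|≡0  = subst (λ c → ℕtoℚ c ≤ℚ ρ * ℕtoℚ (count U))
          (sym (count-empty {A = inside U} (λ e → ≢true⇒false (λ p → |U|≡0 (count-positive (proj₁ (ends e))
                    (∧-trueˡ p))))))
          (0≤* 0≤ρ (0≤ℕtoℚ (count U)))

-- Multiplicities in a greedy packing

isYes-true⁻¹ : ∀ {D : Set} (d : Dec D) → isYes d ≡ true → D
isYes-true⁻¹ (yes p) _ = p

isYes-true : ∀ {D : Set} (d : Dec D) → D → isYes d ≡ true
isYes-true (yes _) _ = refl
isYes-true (no ¬p) p = ⊥-elim (¬p p)

count-prefix : ∀ {k} (f : Fin k → Bool) (j : Fin k) →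
  count (λ i → f i ∧ (toℕ i ℕ.<ᵇ suc (toℕ j))) ≡ count (λ i → f i ∧ (toℕ i ℕ.<ᵇ toℕ j)) ℕ.+ indicator (f j)
count-prefix {suc k} f Fin.zero with f Fin.zero
... | true  = ℕP.+-comm 1 (count (λ i → f (Fin.suc i) ∧ false))
... | false = sym (ℕP.+-identityʳ (count (λ i → f (Fin.suc i) ∧ false)))
count-prefix {suc k} f (Fin.suc j) = trans (cong (indicator (f Fin.zero ∧ true) ℕ.+_) (count-prefix (λ i → f
          (Fin.suc i)) j))
  (sym (ℕP.+-assoc (indicator (f Fin.zero ∧ true)) (count (λ i → f (Fin.suc i) ∧ (toℕ i ℕ.<ᵇ toℕ j)))
            (indicator (f (Fin.suc j)))))

sumℕ-1 : ∀ n → sumℕ {n} (λ _ → 1) ≡ n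
sumℕ-1 zero    = refl
sumℕ-1 (suc n) = cong suc (sumℕ-1 n)

count≤n : ∀ {n} (A : Fin n → Bool) → count A ≤ n
count≤n {n} A = subst (count A ≤_) (sumℕ-1 n) (count-mono {A = A} {λ _ → true} (λ _ _ → refl))

sumℕ-swap : ∀ {m n} (f : Fin m → Fin n → ℕ) → sumℕ (λ i → sumℕ (f i)) ≡ sumℕ (λ j → sumℕ (λ i → f i j))
sumℕ-swap {zero} {n} f = sym (zeros n)
  where
  zeros : ∀ n → sumℕ {n} (λ _ → 0) ≡ 0
  zeros zero    = refl
  zeros (suc n) = zeros n
sumℕ-swap {suc m} f = trans (cong (sumℕ (f Fin.zero) ℕ.+_) (sumℕ-swap (λ i → f (Fin.suc i))))
  (sym (sumℕ-+ (f Fin.zero) (λ j → sumℕ (λ i → f (Fin.suc i) j))))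

positive-ℕtoℚ : ∀ {n} → 1 ≤ n → Positive (ℕtoℚ n)
positive-ℕtoℚ {suc n} _ = normalize-pos (suc n) 1

module _ (G : Multigraph) where
  open Multigraph G

  -- The vertex set of a cycle induces at least as many edges as it has vertices.
  cycle⇒1≤density : Cycle G (allEdges G) → ∀ {ρ} → IsMaxDensity G ρ → 1ℚ ≤ℚ ρ
  cycle⇒1≤density Z {ρ} (density , _) = *-cancelʳ-≤-pos (ℕtoℚ (count S)) {{positive-ℕtoℚ 0<|S|}}
      (≤-trans (≤-reflexive (*-identityˡ (ℕtoℚ (count S))))
        (≤-trans (ℕtoℚ-mono-≤ {count S} |S|≤|E[S]|) (density S 0<|S|)))
    where
    open Cycle Z
    on? : ∀ v → Dec (OnCycle G Z v)
    on? v = FinP.any? (λ j → vs j FinP.≟ v)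
    S : VertexSet G
    S v = isYes (on? v)
    on⇒S : ∀ {v} → OnCycle G Z v → S v ≡ true
    on⇒S {v} = isYes-true (on? v)
    0<|S| : 1 ≤ count S
    0<|S| = count-positive (vs Fin.zero) (on⇒S (Fin.zero , refl))
    |S|≤|E[S]| : count S ≤ inducedCount G S
    |S|≤|E[S]| = count-injection S (inside G S) (λ v e → ∃ λ j → vs j ≡ v × es j ≡ e)
      (λ v Sv → let (j , vj) = isYes-true⁻¹ (on? v) Sv in
        es j , inside-intro G {S} (es-join j) (on⇒S (j , refl)) (on⇒S (next G j , refl)) , j , vj , refl)
      (λ { _ _ _ (i , refl , refl) (j , refl , eq) → cong vs (sym (es-inj eq)) })

  module _ {ρ ε : ℚ} (1≤ρ : 1ℚ ≤ℚ ρ) (maxDensity : IsMaxDensity G ρ) (0<ε : 0ℚ < ε) (ε≤1 : ε ≤ℚ 1ℚ)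
           {k : ℕ} (1≤k : 1 ≤ k) {Ps : Fin k → EdgeSet G} (greedy : IsGreedyPacking G Ps)
           (enough : LnLeQuot m (ℕtoℚ k * ε * ε) (ℕtoℚ 32 * ρ)) where

    multiplicity : Edge G → ℕ
    multiplicity e = count (λ i → Ps i e)

    prefixMultiplicity : ℕ → Edge G → ℕ
    prefixMultiplicity j e = count (λ i → Ps i e ∧ (toℕ i ℕ.<ᵇ j))

    η : ℚ
    η = frac 1 4 * ε

    0<ρ : 0ℚ < ρ
    0<ρ = <-≤-trans (positive⁻¹ 1ℚ) 1≤ρ

    ρ⁻¹ : ℚ
    ρ⁻¹ = (1/ ρ) {{pos⇒nonZero ρ {{positive 0<ρ}}}}

    ρ⁻¹*ρ≡1 : ρ⁻¹ * ρ ≡ 1ℚ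
    ρ⁻¹*ρ≡1 = *-inverseˡ ρ {{pos⇒nonZero ρ {{positive 0<ρ}}}}

    0≤ρ⁻¹ : 0ℚ ≤ℚ ρ⁻¹
    0≤ρ⁻¹ = <⇒≤ (positive⁻¹ ρ⁻¹ {{1/pos⇒pos ρ {{positive 0<ρ}}}})

    0≤η : 0ℚ ≤ℚ η
    0≤η = 0≤* (0≤frac 1 4) (<⇒≤ 0<ε)

    η≤1 : η ≤ℚ 1ℚ
    η≤1 = *-mono-≤ (<⇒≤ 0<ε) 0≤1 (≤-diff (frac 3 4) (0≤frac 3 4) refl) ε≤1

    ηρ⁻¹≤1 : η * ρ⁻¹ ≤ℚ 1ℚ
    ηρ⁻¹≤1 = *-mono-≤ 0≤ρ⁻¹ 0≤1 η≤1
      (subst₂ _≤ℚ_ (*-identityʳ ρ⁻¹) ρ⁻¹*ρ≡1 (*-monoˡ-≤-nonNeg ρ⁻¹ {{nonNegative 0≤ρ⁻¹}} 1≤ρ))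

    potential : ℕ → ℚ
    potential j = sumℚ (λ e → powℚ (1ℚ - η) (prefixMultiplicity j e))

    potential-decay : ∀ j → j ≤ k → potential j ≤ℚ ℕtoℚ m * powℚ (1ℚ - η * ρ⁻¹) j
    potential-decay zero    _   = ≤-reflexive
      (trans (sumℚ-cong (λ e → cong (powℚ (1ℚ - η)) (count-empty (λ i → ∧-false (Ps i e)))))
        (trans (sumℚ-1 m) (sym (*-identityʳ (ℕtoℚ m)))))
      where
      ∧-false : ∀ b → b ∧ false ≡ false
      ∧-false true  = refl
      ∧-false false = refl
    potential-decay (suc j) j<k = begin
      potential (suc j)
        ≤⟨ subst (λ j → potential (suc j) ≤ℚ (1ℚ - η * ρ⁻¹) * potential j) (FinP.toℕ-fromℕ< j<k)
             (potential-step 0≤ρ⁻¹ ρ⁻¹*ρ≡1 0≤η η≤1 (Ps i) (prefixMultiplicity (toℕ i)) (prefixMultiplicity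
                       (suc (toℕ i)))
               (λ e → count-prefix (λ i → Ps i e) i) k (λ e → count≤n (λ i′ → Ps i′ e ∧ (toℕ i′ ℕ.<ᵇ toℕ i)))
               (level-density G (greedy i) 1≤ρ (proj₁ maxDensity))) ⟩
      (1ℚ - η * ρ⁻¹) * potential j
        ≤⟨ *-monoˡ-≤-nonNeg (1ℚ - η * ρ⁻¹) {{nonNegative (p≤q⇒0≤q-p ηρ⁻¹≤1)}} (potential-decay j (ℕP.<⇒≤ j<k)) ⟩
      (1ℚ - η * ρ⁻¹) * (ℕtoℚ m * powℚ (1ℚ - η * ρ⁻¹) j)
        ≡⟨ lem (1ℚ - η * ρ⁻¹) (ℕtoℚ m) (powℚ (1ℚ - η * ρ⁻¹) j) ⟩
      ℕtoℚ m * powℚ (1ℚ - η * ρ⁻¹) (suc j) ∎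
      where
      open ≤-Reasoning
      i = Fin.fromℕ< j<k
      lem : ∀ a b c → a * (b * c) ≡ b * (a * c)
      lem a b c = trans (sym (*-assoc a b c)) (trans (cong (_* c) (*-comm a b)) (*-assoc b a c))

    packing-bound : ∀ e → ℕtoℚ k ≤ℚ ℕtoℚ (multiplicity e) * ((1ℚ + ε) * ρ)
    packing-bound e = let (t , tCρ , N , m≤exp) = enough in
      counting-bound {ρ} {ρ⁻¹} {ε} m k (multiplicity e) N t 1≤ρ ρ⁻¹*ρ≡1 0<ε ε≤1 1≤k tCρ m≤exp
        (≤-trans (≤-reflexive (cong (powℚ (1ℚ - η)) (sumℕ-cong (λ i → all (Ps i e) i))))
          (≤-trans (term≤sumℚ (λ e → 0≤powℚ (p≤q⇒0≤q-p η≤1) (prefixMultiplicity k e)) e) (potential-decay k ℕP.≤-refl)))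
      where
      all : ∀ b (i : Fin k) → indicator b ≡ indicator (b ∧ (toℕ i ℕ.<ᵇ k))
      all true  i rewrite <ᵇ-true (FinP.toℕ<n i) = refl
      all false i = refl

    -- Multiplicity zero would turn the quantitative bound into `k ≤ 0`; covering is a by-product.
    multiplicity-positive : ∀ e → 1 ≤ multiplicity e
    multiplicity-positive e = ℕP.≮⇒≥ λ { c<1 → <⇒≱ (positive⁻¹ (ℕtoℚ k) {{positive-ℕtoℚ 1≤k}})
      (subst (ℕtoℚ k ≤ℚ_) (trans (cong (λ c → ℕtoℚ c * ((1ℚ + ε) * ρ)) (ℕP.n<1⇒n≡0 c<1)) (*-zeroˡ ((1ℚ + ε) * ρ)))
        (packing-bound e)) }

    covered : ∀ e → ∃ λ i → Ps i e ≡ true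
    covered e with FinP.any? (λ i → Ps i e ≟ᵇ true)
    ... | yes p = p
    ... | no np = ⊥-elim (ℕP.<-irrefl (sym (count-empty (λ i → ≢true⇒false (λ p → np (i , p)))))
              (multiplicity-positive e))

    -- After scaling by `k`, an edge contributes at most `(1 + ε)ρ` times the number of indices for
    -- which it leaves `u`. Summed by index instead of by edge, these numbers total at most `k`.
    outdeg-bound : (os : Fin k → Orientation G) → (∀ i → IsOrientationOf G (Ps i) (os i)) →
                   ∀ u → outdeg G Ps os u ≤ℚ (1ℚ + ε) * ρ
    outdeg-bound os oriented u = *-cancelˡ-≤-pos (ℕtoℚ k) {{positive-ℕtoℚ 1≤k}} (begin
      ℕtoℚ k * outdeg G Ps os u                 ≡⟨ sumℚ-*ˡ (ℕtoℚ k) (λ e → share e) ⟨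
      sumℚ (λ e → ℕtoℚ k * share e)             ≤⟨ sumℚ-mono share-bound ⟩
      sumℚ (λ e → B * ℕtoℚ (out e))             ≡⟨ sumℚ-*ˡ B (λ e → ℕtoℚ (out e)) ⟩
      B * sumℚ (λ e → ℕtoℚ (out e))             ≡⟨ cong (B *_) (sumℚ-ℕtoℚ out) ⟩
      B * ℕtoℚ (sumℕ out)                       ≤⟨ *-monoˡ-≤-nonNeg B {{nonNegative 0≤B}}
                (ℕtoℚ-mono-≤ {sumℕ out} total) ⟩
      B * ℕtoℚ k                                ≡⟨ *-comm B (ℕtoℚ k) ⟩
      ℕtoℚ k * B                                ∎)
      where
      open ≤-Reasoning
      B : ℚ
      B = (1ℚ + ε) * ρ
      0≤B : 0ℚ ≤ℚ B
      0≤B = 0≤* (0≤+ 0≤1 (<⇒≤ 0<ε)) (<⇒≤ 0<ρ)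
      leaves : Edge G → Fin k → Bool
      leaves e i = Ps i e ∧ isYes (Tail G (os i) e FinP.≟ u)
      out : Edge G → ℕ
      out e = count (leaves e)
      share : Edge G → ℚ
      share e = if isYes (proj₁ (ends e) FinP.≟ u) ∨ isYes (proj₂ (ends e) FinP.≟ u) then fracOut G Ps os e u else 0ℚ
      0≤Bout : ∀ e → 0ℚ ≤ℚ B * ℕtoℚ (out e)
      0≤Bout e = 0≤* 0≤B (0≤ℕtoℚ (out e))
      frac-bound : ∀ a c → 1 ≤ c → ℕtoℚ k ≤ℚ ℕtoℚ c * B → ℕtoℚ k * frac a c ≤ℚ B * ℕtoℚ a
      frac-bound a (suc c) _ le = ≤-trans (*-monoʳ-≤-nonNeg (frac a (suc c)) {{nonNegative (0≤frac a (suc c))}} le)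
        (≤-reflexive (trans (cong (_* frac a (suc c)) (*-comm (ℕtoℚ (suc c)) B))
          (trans (*-assoc B (ℕtoℚ (suc c)) (frac a (suc c))) (cong (B *_) (frac-* a c)))))
      share-bound : ∀ e → ℕtoℚ k * share e ≤ℚ B * ℕtoℚ (out e)
      share-bound e with isYes (proj₁ (ends e) FinP.≟ u) ∨ isYes (proj₂ (ends e) FinP.≟ u)
      ... | true  = frac-bound (out e) (multiplicity e) (multiplicity-positive e) (packing-bound e)
      ... | false = subst (_≤ℚ B * ℕtoℚ (out e)) (sym (*-zeroʳ (ℕtoℚ k))) (0≤Bout e)
      total : sumℕ out ≤ k
      total = subst₂ _≤_ (sym (sumℕ-swap (λ e i → indicator (leaves e i)))) (sumℕ-1 k)
        -- An injection into a one-element set expresses that at most one edge of `Ps i` leaves `u`.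
        (sumℕ-mono (λ i → count-injection (λ e → leaves e i) (λ (_ : Fin 1) → true)
          (λ e _ → Ps i e ≡ true × Tail G (os i) e ≡ u)
          (λ e p → Fin.zero , refl , ∧-trueˡ p , isYes-true⁻¹ (Tail G (os i) e FinP.≟ u) (∧-trueʳ {Ps i e} p))
          (λ { e f _ (Pe , te) (Pf , tf) →
            orientation-out-degree G (proj₁ (proj₁ (greedy i))) (oriented i) Pe Pf te tf })))

theorem11 : Σ ℚ λ C → (0ℚ < C) ×
    (∀ (G : Multigraph) → Cycle G (allEdges G) →
    ∀ (ρ : ℚ) → IsMaxDensity G ρ →
    ∀ (ε : ℚ) → 0ℚ < ε → ε ≤ℚ 1ℚ →
    ∀ (k : ℕ) → 1 ≤ k →
    ∀ (Ps : Fin k → EdgeSet G) → IsGreedyPacking G Ps →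
    LnLeQuot (Multigraph.m G) (ℕtoℚ k * ε * ε) (C * ρ) →
    (∀ (e : Edge G) → ∃ λ i → Ps i e ≡ true) ×
    (∀ (os : Fin k → Orientation G) → (∀ i → IsOrientationOf G (Ps i) (os i)) →
    ∀ (u : Vertex G) → outdeg G Ps os u ≤ℚ (1ℚ + ε) * ρ))
theorem11 = ℕtoℚ 32 , positive⁻¹ (ℕtoℚ 32) , λ G Z ρ maxDensity ε 0<ε ε≤1 k 1≤k Ps greedy enough →
  let 1≤ρ = cycle⇒1≤density G Z maxDensity in
  covered G 1≤ρ maxDensity 0<ε ε≤1 1≤k greedy enough ,
  outdeg-bound G 1≤ρ maxDensity 0<ε ε≤1 1≤k greedy enough
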